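{- Let $r\ge2$ and let $\mathbb{RM}^{(r)}_n$ be an ordered $r$-matching chosen uniformly at random among all ordered $r$-matchings on $[rn]$. Then there is a constant $c>0$ depending only on $r$ such that, with probability tending to $1$ as $n\to\infty$, $\mathbb{RM}^{(r)}_n$ contains a line of size at least $cn^{1/r}$.
   Context: An ordered $r$-matching on $[rn]$ is a set of $n$ pairwise disjoint $r$-element subsets (edges) of $[rn]$ covering $[rn]$. A line of size $k$ in such a matching is a set of $k$ of its edges $e_1,\dots,e_k$ such that every vertex of $e_i$ is smaller than every vertex of $e_{i+1}$ for all $i<k$ (i.e. every pair of them forms the alignment pattern $A^rB^r$). -}

module Defs where

open import Data.Bool using (Bool; true; false; _∧_; _∨_; not)
open import Data.Nat as ℕ using (ℕ; zero; suc; _+_; _*_; _^_; _≤?_; _<?_)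
open import Data.Fin using (Fin; toℕ)
open import Data.Fin.Properties using (_≟_)
open import Data.Bool.ListAction using (all; any)
open import Data.List using (List; []; _∷_; map; concatMap; length; filterᵇ; allFin; upTo)
open import Data.Vec using (Vec; lookup; toList)
import Data.Vec as V
open import Relation.Nullary.Decidable using (⌊_⌋)

allVecs : {A : Set} → List A → (k : ℕ) → List (Vec A k)
allVecs xs zero    = V.[] ∷ []
allVecs xs (suc k) = concatMap (λ x → map (x V.∷_) (allVecs xs k)) xs

-- An ordered r-matching on [rn] is encoded by a labelling
-- v : Vec (Fin n) (r * n) of the vertices 0,…,rn-1 by edge names 0,…,n-1,
-- such that every edge name is used exactly r times; the matching is
-- { v⁻¹(i) : i < n }.  Every matching has exactly n! labellings, so the
-- uniform distribution on labellings induces the uniform distribution on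
-- matchings.

occ : {n m : ℕ} → Vec (Fin n) m → Fin n → ℕ
occ v i = length (filterᵇ (λ x → ⌊ x ≟ i ⌋) (toList v))

isMatchingᵇ : (r n : ℕ) → Vec (Fin n) (r * n) → Bool
isMatchingᵇ r n v = all (λ i → ⌊ occ v i ℕ.≟ r ⌋) (allFin n)

edgeBeforeᵇ : {n m : ℕ} → Vec (Fin n) m → Fin n → Fin n → Bool
edgeBeforeᵇ {n} {m} v a b =
  all (λ p → all (λ q → not (⌊ lookup v p ≟ a ⌋ ∧ ⌊ lookup v q ≟ b ⌋) ∨ ⌊ toℕ p <? toℕ q ⌋)
                 (allFin m))
      (allFin m)

isLineᵇ : {n m : ℕ} → Vec (Fin n) m → List (Fin n) → Bool
isLineᵇ v []            = true
isLineᵇ v (x ∷ [])      = true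
isLineᵇ v (x ∷ y ∷ xs)  = edgeBeforeᵇ v x y ∧ isLineᵇ v (y ∷ xs)

hasLineᵇ : {n m : ℕ} → Vec (Fin n) m → ℕ → Bool
hasLineᵇ {n} v k = any (λ ℓ → isLineᵇ v (toList ℓ)) (allVecs (allFin n) k)

-- contains a line of size k for some k with k ≥ c n^{1/r}, where c^r = a / b,
-- i.e. a * n ≤ b * k ^ r  (lines have size ≤ n, so k ranges over 0…n)
hasLargeLineᵇ : (r a b n : ℕ) → Vec (Fin n) (r * n) → Bool
hasLargeLineᵇ r a b n v =
  any (λ k → ⌊ a * n ≤? b * k ^ r ⌋ ∧ hasLineᵇ v k) (upTo (suc n))

numMatchings : (r n : ℕ) → ℕ
numMatchings r n = length (filterᵇ (isMatchingᵇ r n) (allVecs (allFin n) (r * n)))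

numBad : (r a b n : ℕ) → ℕ
numBad r a b n =
  length (filterᵇ (λ v → isMatchingᵇ r n v ∧ not (hasLargeLineᵇ r a b n v))
                  (allVecs (allFin n) (r * n)))

{-# OPTIONS --safe #-}

-- Place the n edges one after the other, each as an ordered r-tuple of free positions chosen
-- uniformly, and cut the positions into 8t blocks of equal length, where t is about n^(1/r)/128.
-- Call an edge a hit if it lies in one block that contains no earlier hit; picking the hits from
-- left to right gives a line. As long as half of the positions are free and there are fewer than t
-- hits, most free positions lie in unhit blocks with many free positions, so whatever happened
-- before, the next edge is a hit with probability at least 1/D, D = 8 (128 t)^(r-1). Hence the
-- expectation of 2^(t - #hits), restricted to fewer than t hits, shrinks by a factor 1 - 1/(2D) per
-- edge. After 4 D t ≤ n/2 edges it is at most 2^t (1 - 1/(2D))^(4Dt) ≤ 2^(-t), which bounds the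
-- probability that there is no line of size t.
module Submission where

open import Defs
open import Data.Bool using (if_then_else_; Bool; false; T; T?; not; _∧_; _∨_)
open import Data.Bool.ListAction using (all)
open import Data.Bool.Properties using (T-∧)
open import Data.Empty using (⊥)
import Data.Fin as F
open import Data.Fin using (Fin; toℕ; fromℕ<)
import Data.Fin.Properties as Fin
open import Data.List
  using (List; []; _∷_; map; concatMap; length; filter; allFin; _++_; _ʳ++_; filterᵇ; upTo)
open import Data.List.Membership.Propositional using (_∈_; _∉_; find; lose)
open import Data.List.Membership.Propositional.Properties
  using (∈-allFin; ∈-filter⁻; ∈-filter⁺; ∈-concatMap⁻; ∈-map⁻; ∈-map⁺; ∈-length; ∈-concatMap⁺;
    ∈-upTo⁺)
open import Data.List.Properties
  using (map-++; length-tabulate; map-tabulate; length-map; length-upTo)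
open import Data.List.Relation.Unary.All as All using (All; []; _∷_; all?)
open import Data.List.Relation.Unary.All.Properties using (all⁺; all⁻; ¬All⇒Any¬)
open import Data.List.Relation.Unary.AllPairs using (AllPairs; []; _∷_)
open import Data.List.Relation.Unary.Any as Any using (Any; here; there)
open import Data.List.Relation.Unary.Any.Properties using (any⁺)
open import Data.List.Relation.Unary.Unique.Propositional using (Unique)
open import Data.List.Relation.Unary.Unique.Propositional.Properties using (allFin⁺)
import Data.Nat as ℕ
open import Data.Nat
  using (ℕ; zero; suc; _+_; _*_; _∸_; _^_; _≤_; _<_; z≤n; s≤s; pred; _!; NonZero; >-nonZero)
open import Data.Nat.DivMod
  using (_/_; _%_; m≡m%n+[m/n]*n; m%n<n; m/n*n≤m; /-monoˡ-≤; m<n*o⇒m/o<n; m*n/n≡m)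
open import Data.Nat.ListAction using (sum; product)
open import Data.Nat.ListAction.Properties using (sum-++)
open import Data.Nat.Properties
open import Data.Nat.Tactic.RingSolver using (solve-∀)
open import Data.Product using (Σ; _×_; _,_; proj₁; proj₂; ∃)
open import Data.Sum using (_⊎_; inj₁; inj₂)
open import Data.Unit using (tt)
import Data.Vec as V
open import Data.Vec using (Vec; lookup; tabulate; toList; fromList)
import Data.Vec.Properties as V
open import Function using (_∘_; id)
open import Function.Bundles using (Equivalence)
open import Relation.Binary.PropositionalEquality
open import Relation.Nullary using (¬_; Dec; yes; no; ¬?; contradiction; does)
open import Relation.Nullary.Decidable
  using (_×-dec_; dec-true; dec-false; decidable-stable; ⌊_⌋; toWitness; fromWitness)
open import Relation.Unary using (Decidable)
open import Data.List.Membership.DecPropositional ℕ._≟_ using () renaming (_∈?_ to _∈ℕ?_)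

-- The obstacle is dependence: the edges of a random matching compete for positions. A lower bound
-- on the chance of a hit that is uniform over every past stands in for independence, and the
-- exponential weight turns it into a tail bound with no variance computation. The weight has to
-- vanish at t hits, because the count of free positions lost to hit blocks is under control only
-- for up to t such blocks.
--
-- Nothing is ever divided. A conditional expectation is a sum over all continuations of a partial
-- placement; this is a faithful substitute because the number of continuations depends only on how
-- many edges are left and how many positions are free. Each labelled matching arises from exactly
-- (r!)^n placements, one factor r! per edge for the order of its tuple, so passing from matchings
-- to placements preserves ratios.

private variable
  A B : Set
  P Q : Set

-- Sums over lists and indicators

∑ : List A → (A → ℕ) → ℕ
∑ xs f = sum (map f xs)

∑-++ : (xs ys : List A) (f : A → ℕ) → ∑ (xs ++ ys) f ≡ ∑ xs f + ∑ ys f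
∑-++ xs ys f = trans (cong sum (map-++ f xs ys)) (sum-++ (map f xs) (map f ys))

∑-map : (g : A → B) (xs : List A) (f : B → ℕ) → ∑ (map g xs) f ≡ ∑ xs (f ∘ g)
∑-map g [] f = refl
∑-map g (x ∷ xs) f = cong (f (g x) +_) (∑-map g xs f)

∑-concatMap : (g : A → List B) (xs : List A) (f : B → ℕ) →
  ∑ (concatMap g xs) f ≡ ∑ xs (λ x → ∑ (g x) f)
∑-concatMap g [] f = refl
∑-concatMap g (x ∷ xs) f =
  trans (∑-++ (g x) (concatMap g xs) f) (cong (∑ (g x) f +_) (∑-concatMap g xs f))

∑-cong : (xs : List A) {f g : A → ℕ} → (∀ {x} → x ∈ xs → f x ≡ g x) → ∑ xs f ≡ ∑ xs g
∑-cong [] eq = refl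
∑-cong (x ∷ xs) eq = cong₂ _+_ (eq (here refl)) (∑-cong xs (eq ∘ there))

∑-mono : (xs : List A) {f g : A → ℕ} → (∀ {x} → x ∈ xs → f x ≤ g x) → ∑ xs f ≤ ∑ xs g
∑-mono [] le = z≤n
∑-mono (x ∷ xs) le = +-mono-≤ (le (here refl)) (∑-mono xs (le ∘ there))

∑-*ˡ : (xs : List A) (k : ℕ) (f : A → ℕ) → ∑ xs (λ x → k * f x) ≡ k * ∑ xs f
∑-*ˡ [] k f = sym (*-zeroʳ k)
∑-*ˡ (x ∷ xs) k f =
  trans (cong (k * f x +_) (∑-*ˡ xs k f)) (sym (*-distribˡ-+ k (f x) (∑ xs f)))

∑-*ʳ : (xs : List A) (f : A → ℕ) (k : ℕ) → ∑ xs (λ x → f x * k) ≡ ∑ xs f * k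
∑-*ʳ xs f k =
  trans (∑-cong xs (λ {x} _ → *-comm (f x) k)) (trans (∑-*ˡ xs k f) (*-comm k (∑ xs f)))

∑-+ : (xs : List A) (f g : A → ℕ) → ∑ xs (λ x → f x + g x) ≡ ∑ xs f + ∑ xs g
∑-+ [] f g = refl
∑-+ (x ∷ xs) f g rewrite ∑-+ xs f g = interchange (f x) (g x) (∑ xs f) (∑ xs g)
  where
  interchange : ∀ a b c d → a + b + (c + d) ≡ a + c + (b + d)
  interchange = solve-∀

∑-const : (xs : List A) (k : ℕ) → ∑ xs (λ _ → k) ≡ length xs * k
∑-const [] k = refl
∑-const (x ∷ xs) k = cong (k +_) (∑-const xs k)

length≡∑ : (xs : List A) → length xs ≡ ∑ xs (λ _ → 1)
length≡∑ xs = sym (trans (∑-const xs 1) (*-identityʳ (length xs)))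

∑-swap : (xs : List A) (ys : List B) (f : A → B → ℕ) →
  ∑ xs (λ x → ∑ ys (f x)) ≡ ∑ ys (λ y → ∑ xs (λ x → f x y))
∑-swap [] ys f = sym (trans (∑-const ys 0) (*-zeroʳ (length ys)))
∑-swap (x ∷ xs) ys f =
  trans (cong (∑ ys (f x) +_) (∑-swap xs ys f)) (sym (∑-+ ys (f x) (λ y → ∑ xs (λ x → f x y))))

term≤∑ : {xs : List A} {x : A} (f : A → ℕ) → x ∈ xs → f x ≤ ∑ xs f
term≤∑ f (here refl) = m≤m+n _ _
term≤∑ f (there x∈) = ≤-trans (term≤∑ f x∈) (m≤n+m _ _)

ι : Dec P → ℕ
ι (yes _) = 1
ι (no _)  = 0

ι-yes : (p : Dec P) → P → ι p ≡ 1
ι-yes (yes _) _ = refl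
ι-yes (no ¬p) p = contradiction p ¬p

ι-no : (p : Dec P) → ¬ P → ι p ≡ 0
ι-no (yes p) ¬p = contradiction p ¬p
ι-no (no _)  _  = refl

ι≤1 : (p : Dec P) → ι p ≤ 1
ι≤1 (yes _) = s≤s z≤n
ι≤1 (no _)  = z≤n

ι-mono : (p : Dec P) (q : Dec Q) → (P → Q) → ι p ≤ ι q
ι-mono (yes p) q f = ≤-reflexive (sym (ι-yes q (f p)))
ι-mono (no _)  q f = z≤n

ι-cong : (p : Dec P) (q : Dec Q) → (P → Q) → (Q → P) → ι p ≡ ι q
ι-cong p q f g = ≤-antisym (ι-mono p q f) (ι-mono q p g)

ι-× : (p : Dec P) (q : Dec Q) → ι (p ×-dec q) ≡ ι p * ι q
ι-× (yes _) (yes _) = refl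
ι-× (yes _) (no _)  = refl
ι-× (no _)  _       = refl

ι-¬ : (p : Dec P) → ι p + ι (¬? p) ≡ 1
ι-¬ (yes _) = refl
ι-¬ (no _)  = refl

∑-filter : {P : A → Set} (P? : Decidable P) (xs : List A) (f : A → ℕ) →
  ∑ (filter P? xs) f ≡ ∑ xs (λ x → ι (P? x) * f x)
∑-filter P? [] f = refl
∑-filter P? (x ∷ xs) f with P? x
... | yes _ = cong₂ _+_ (sym (+-identityʳ (f x))) (∑-filter P? xs f)
... | no _  = ∑-filter P? xs f

∑-zero : (xs : List A) {f : A → ℕ} → (∀ {x} → x ∈ xs → f x ≡ 0) → ∑ xs f ≡ 0
∑-zero xs eq = trans (∑-cong xs eq) (trans (∑-const xs 0) (*-zeroʳ (length xs)))

∑-point : {xs : List A} (_≟_ : (x y : A) → Dec (x ≡ y)) (f : A → ℕ) → Unique xs →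
  {a : A} → a ∈ xs → ∑ xs (λ x → ι (x ≟ a) * f x) ≡ f a
∑-point {xs = x ∷ xs} _≟_ f (x∉ ∷ _) (here refl) = begin
  ι (x ≟ x) * f x + ∑ xs (λ y → ι (y ≟ x) * f y)
    ≡⟨ cong₂ _+_ (cong (_* f x) (ι-yes (x ≟ x) refl))
                 (∑-zero xs (λ {y} y∈ → cong (_* f y) (ι-no (y ≟ x) (All.lookup x∉ y∈ ∘ sym)))) ⟩
  1 * f x + 0 ≡⟨ +-identityʳ _ ⟩
  1 * f x     ≡⟨ *-identityˡ _ ⟩
  f x         ∎
  where open ≡-Reasoning
∑-point {xs = x ∷ xs} _≟_ f (x∉ ∷ u) {a} (there a∈) =
  trans (cong (λ z → z * f x + _) (ι-no (x ≟ a) (All.lookup x∉ a∈)))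
        (∑-point _≟_ f u a∈)

∑-allFin-point : ∀ {m} (f : Fin m → ℕ) (a : Fin m) →
  ∑ (allFin m) (λ x → ι (x Fin.≟ a) * f x) ≡ f a
∑-allFin-point {m} f a = ∑-point Fin._≟_ f (allFin⁺ m) (∈-allFin a)

-- Falling factorials

fall : ℕ → ℕ → ℕ
fall f zero    = 1
fall f (suc k) = f * fall (pred f) k

fall-self : ∀ k → fall k k ≡ k !
fall-self zero    = refl
fall-self (suc k) = cong (suc k *_) (fall-self k)

fall-zero : ∀ {f k} → f < k → fall f k ≡ 0
fall-zero {zero}  {suc k} _         = refl
fall-zero {suc f} {suc k} (s≤s f<k) = trans (cong (suc f *_) (fall-zero f<k)) (*-zeroʳ (suc f))

fall≤^ : ∀ f k → fall f k ≤ f ^ k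
fall≤^ f zero    = ≤-refl
fall≤^ f (suc k) = *-monoʳ-≤ f (≤-trans (fall≤^ (pred f) k) (^-monoˡ-≤ k (pred[n]≤n {f})))

-- Even the smallest of the k factors, f - k + 1, exceeds a.
^≤fall : ∀ {f} a k → a + k ≤ f → a ^ k ≤ fall f k
^≤fall a zero    _ = ≤-refl
^≤fall {f} a (suc k) le =
  *-mono-≤ (≤-trans (m≤m+n a (suc k)) le)
           (^≤fall a k (≤-trans (≤-reflexive (sym (cong pred (+-suc a k)))) (pred-mono-≤ le)))

-- Tuples of distinct positions

module _ {m : ℕ} where

  open import Data.List.Membership.DecPropositional (Fin._≟_ {m}) using (_∈?_) public

  free : List (Fin m) → List (Fin m)
  free us = filter (λ x → ¬? (x ∈? us)) (allFin m)

  -- Occupying a position acts on every count through this rule: the number of free positions and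
  -- the number of those with a given property are both sums over `free us`.
  ∑-free-∷ : ∀ {us x} (f : Fin m → ℕ) → x ∈ free us → ∑ (free us) f ≡ f x + ∑ (free (x ∷ us)) f
  ∑-free-∷ {us} {x} f x∈ = begin
    ∑ (free us) f
      ≡⟨ ∑-filter _ (allFin m) f ⟩
    ∑ (allFin m) (λ y → ι (¬? (y ∈? us)) * f y)
      ≡⟨ ∑-cong (allFin m) (λ {y} _ → split y) ⟩
    ∑ (allFin m) (λ y → ι (y Fin.≟ x) * f y + ι (¬? (y ∈? (x ∷ us))) * f y)
      ≡⟨ ∑-+ (allFin m) _ _ ⟩
    ∑ (allFin m) (λ y → ι (y Fin.≟ x) * f y) + ∑ (allFin m) (λ y → ι (¬? (y ∈? (x ∷ us))) * f y)
      ≡⟨ cong₂ _+_ (∑-allFin-point f x) (sym (∑-filter _ (allFin m) f)) ⟩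
    f x + ∑ (free (x ∷ us)) f ∎
    where
    open ≡-Reasoning
    x∉ : x ∉ us
    x∉ = proj₂ (∈-filter⁻ (λ x → ¬? (x ∈? us)) {xs = allFin m} x∈)
    indicators : ∀ y → Dec (y ≡ x) → ι (¬? (y ∈? us)) ≡ ι (y Fin.≟ x) + ι (¬? (y ∈? (x ∷ us)))
    indicators y (yes refl) = trans (ι-yes (¬? (y ∈? us)) x∉)
      (sym (cong₂ _+_ (ι-yes (y Fin.≟ y) refl)
                      (ι-no (¬? (y ∈? (y ∷ us))) (λ y∉ → y∉ (here refl)))))
    indicators y (no y≢x) =
      trans (ι-cong (¬? (y ∈? us)) (¬? (y ∈? (x ∷ us)))
               (λ y∉ → λ { (here eq) → y≢x eq ; (there y∈) → y∉ y∈ }) (λ y∉ → y∉ ∘ there))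
            (cong (_+ ι (¬? (y ∈? (x ∷ us)))) (sym (ι-no (y Fin.≟ x) y≢x)))
    split : ∀ y → ι (¬? (y ∈? us)) * f y ≡ ι (y Fin.≟ x) * f y + ι (¬? (y ∈? (x ∷ us))) * f y
    split y = trans (cong (_* f y) (indicators y (y Fin.≟ x)))
                    (*-distribʳ-+ (f y) (ι (y Fin.≟ x)) (ι (¬? (y ∈? (x ∷ us)))))

  freeCount : {P : Fin m → Set} → Decidable P → List (Fin m) → ℕ
  freeCount P? us = ∑ (free us) (λ x → ι (P? x))

  ∣free∣ : List (Fin m) → ℕ
  ∣free∣ us = length (free us)

  ∣free∣-∷ : ∀ {us x} → x ∈ free us → ∣free∣ us ≡ suc (∣free∣ (x ∷ us))
  ∣free∣-∷ {us} {x} x∈ = trans (length≡∑ (free us))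
    (trans (∑-free-∷ (λ _ → 1) x∈) (cong suc (sym (length≡∑ (free (x ∷ us))))))

  tuples : ℕ → List (Fin m) → List (List (Fin m))
  tuples zero    us = [] ∷ []
  tuples (suc k) us = concatMap (λ x → map (x ∷_) (tuples k (x ∷ us))) (free us)

  ∑-tuples-suc : ∀ k us (f : List (Fin m) → ℕ) →
    ∑ (tuples (suc k) us) f ≡ ∑ (free us) (λ x → ∑ (tuples k (x ∷ us)) (λ c → f (x ∷ c)))
  ∑-tuples-suc k us f =
    trans (∑-concatMap _ (free us) f)
          (∑-cong (free us) (λ {x} _ → ∑-map (x ∷_) (tuples k (x ∷ us)) f))

  -- A first entry satisfying `P` leaves one fewer free position with `P`; a first entry violating
  -- it contributes nothing. Used both for tuples inside one block and for tuples of positions with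
  -- a given letter.
  tuples-count : {P : Fin m → Set} (P? : Decidable P) (k : ℕ) (us : List (Fin m)) →
    ∑ (tuples k us) (λ c → ι (all? P? c)) ≡ fall (freeCount P? us) k
  tuples-count P? zero    us = refl
  tuples-count P? (suc k) us = begin
    ∑ (tuples (suc k) us) (λ c → ι (all? P? c))
      ≡⟨ ∑-tuples-suc k us _ ⟩
    ∑ (free us) (λ x → ∑ (tuples k (x ∷ us)) (λ c → ι (all? P? (x ∷ c))))
      ≡⟨ ∑-cong (free us) (λ {x} x∈ → begin
           ∑ (tuples k (x ∷ us)) (λ c → ι (all? P? (x ∷ c)))
             ≡⟨ ∑-cong (tuples k (x ∷ us)) (λ {c} _ → trans
                  (ι-cong (all? P? (x ∷ c)) (P? x ×-dec all? P? c)
                          (λ { (p ∷ ps) → p , ps }) (λ { (p , ps) → p ∷ ps }))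
                  (ι-× (P? x) (all? P? c))) ⟩
           ∑ (tuples k (x ∷ us)) (λ c → ι (P? x) * ι (all? P? c))
             ≡⟨ ∑-*ˡ (tuples k (x ∷ us)) (ι (P? x)) _ ⟩
           ι (P? x) * ∑ (tuples k (x ∷ us)) (λ c → ι (all? P? c))
             ≡⟨ cong (ι (P? x) *_) (tuples-count P? k (x ∷ us)) ⟩
           ι (P? x) * fall (freeCount P? (x ∷ us)) k
             ≡⟨ one-less x∈ ⟩
           ι (P? x) * fall (pred (freeCount P? us)) k ∎) ⟩
    ∑ (free us) (λ x → ι (P? x) * fall (pred (freeCount P? us)) k)
      ≡⟨ ∑-*ʳ (free us) (λ x → ι (P? x)) _ ⟩
    freeCount P? us * fall (pred (freeCount P? us)) k ∎
    where
    open ≡-Reasoning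
    one-less : ∀ {x} → x ∈ free us →
      ι (P? x) * fall (freeCount P? (x ∷ us)) k ≡ ι (P? x) * fall (pred (freeCount P? us)) k
    one-less {x} x∈ with P? x | ∑-free-∷ {us} (λ x → ι (P? x)) x∈
    ... | no _  | _  = refl
    ... | yes _ | eq = cong (λ z → 1 * fall (pred z) k) (sym eq)

  length-tuples : ∀ k us → length (tuples k us) ≡ fall (∣free∣ us) k
  length-tuples zero    us = refl
  length-tuples (suc k) us = begin
    length (tuples (suc k) us)
      ≡⟨ length≡∑ (tuples (suc k) us) ⟩
    ∑ (tuples (suc k) us) (λ _ → 1)
      ≡⟨ ∑-tuples-suc k us _ ⟩
    ∑ (free us) (λ x → ∑ (tuples k (x ∷ us)) (λ _ → 1))
      ≡⟨ ∑-cong (free us) (λ {x} x∈ → trans (sym (length≡∑ (tuples k (x ∷ us))))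
           (trans (length-tuples k (x ∷ us)) (cong (λ z → fall (pred z) k) (sym (∣free∣-∷ x∈))))) ⟩
    ∑ (free us) (λ _ → fall (pred (∣free∣ us)) k)
      ≡⟨ ∑-const (free us) _ ⟩
    ∣free∣ us * fall (pred (∣free∣ us)) k ∎
    where open ≡-Reasoning

∈-ʳ++⁻ : {x : A} (xs : List A) {ys : List A} → x ∈ xs ʳ++ ys → x ∈ xs ⊎ x ∈ ys
∈-ʳ++⁻ []       x∈ = inj₂ x∈
∈-ʳ++⁻ (y ∷ xs) x∈ with ∈-ʳ++⁻ xs x∈
... | inj₁ x∈xs         = inj₁ (there x∈xs)
... | inj₂ (here refl)  = inj₁ (here refl)
... | inj₂ (there x∈ys) = inj₂ x∈ys

∈-ʳ++⁺ʳ : {x : A} (xs : List A) {ys : List A} → x ∈ ys → x ∈ xs ʳ++ ys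
∈-ʳ++⁺ʳ []       x∈ = x∈
∈-ʳ++⁺ʳ (y ∷ xs) x∈ = ∈-ʳ++⁺ʳ xs (there x∈)

module _ {m : ℕ} where

  tuples-disjoint : ∀ k {us c : List (Fin m)} → c ∈ tuples k us → All (_∉ us) c
  tuples-disjoint zero (here refl) = []
  tuples-disjoint (suc k) {us} c∈ with find (∈-concatMap⁻ _ {xs = free us} c∈)
  ... | x , x∈ , c∈′ with ∈-map⁻ (x ∷_) c∈′
  ... | c′ , c′∈ , refl =
    proj₂ (∈-filter⁻ (λ x → ¬? (x ∈? us)) {xs = allFin m} x∈)
    ∷ All.map (_∘ there) (tuples-disjoint k c′∈)

  tuples-free : ∀ k {us c : List (Fin m)} → c ∈ tuples k us → ∣free∣ us ≡ k + ∣free∣ (c ʳ++ us)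
  tuples-free zero (here refl) = refl
  tuples-free (suc k) {us} c∈ with find (∈-concatMap⁻ _ {xs = free us} c∈)
  ... | x , x∈ , c∈′ with ∈-map⁻ (x ∷_) c∈′
  ... | c′ , c′∈ , refl = trans (∣free∣-∷ x∈) (cong suc (tuples-free k c′∈))

  ∣free∣≡0⇒∈ : ∀ {us} → ∣free∣ us ≡ 0 → (x : Fin m) → x ∈ us
  ∣free∣≡0⇒∈ {us} eq x = decidable-stable (x ∈? us) λ x∉ →
    <⇒≢ (∈-length (∈-filter⁺ (λ x → ¬? (x ∈? us)) (∈-allFin x) x∉)) (sym eq)

-- Arrangements: edges placed one after the other

∏ : List A → (A → ℕ) → ℕ
∏ xs f = product (map f xs)

module Arrangements {m n : ℕ} (r : ℕ) where

  State : Set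
  State = List (Fin n × List (Fin m))

  labels : State → List (Fin n)
  labels = map proj₁

  -- `ʳ++` follows the order in which `tuples` pushes positions onto the used list: `(x ∷ c) ʳ++ us`
  -- reduces to `c ʳ++ (x ∷ us)`, so inductions over a tuple need no rewriting.
  used : State → List (Fin m)
  used []            = []
  used ((e , c) ∷ σ) = c ʳ++ used σ

  arr : List (Fin n) → State → List State
  arr []       σ = σ ∷ []
  arr (e ∷ es) σ = concatMap (λ c → arr es ((e , c) ∷ σ)) (tuples r (used σ))

  ∑-arr-∷ : ∀ e es σ (f : State → ℕ) →
    ∑ (arr (e ∷ es) σ) f ≡ ∑ (tuples r (used σ)) (λ c → ∑ (arr es ((e , c) ∷ σ)) f)
  ∑-arr-∷ e es σ f = ∑-concatMap _ (tuples r (used σ)) f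

  arr-∷⁻ : ∀ {e es σ τ} → τ ∈ arr (e ∷ es) σ →
    ∃ λ c → c ∈ tuples r (used σ) × τ ∈ arr es ((e , c) ∷ σ)
  arr-∷⁻ {σ = σ} τ∈ = find (∈-concatMap⁻ _ {xs = tuples r (used σ)} τ∈)

  data Valid : State → Set where
    []  : Valid []
    _∷_ : ∀ {e c σ} → e ∉ labels σ × All (_∉ used σ) c → Valid σ → Valid ((e , c) ∷ σ)

  Apart : List (Fin n) → State → Set
  Apart es σ = All (_∉ labels σ) es

  apart-∷ : ∀ {e c es σ} → All (e ≢_) es → Apart es σ → Apart es ((e , c) ∷ σ)
  apart-∷ e∉ ap = All.zipWith
    (λ (e≢ , ∉σ) → λ { (here eq) → e≢ (sym eq) ; (there ∈σ) → ∉σ ∈σ }) (e∉ , ap)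

  arr-valid : ∀ {es σ τ} → Unique es → Apart es σ → Valid σ → τ ∈ arr es σ → Valid τ
  arr-valid {[]} _ _ v (here refl) = v
  arr-valid {e ∷ es} {σ} (e∉ ∷ u) (∉σ ∷ ap) v τ∈ with arr-∷⁻ {es = es} {σ} τ∈
  ... | c , c∈ , τ∈′ = arr-valid u (apart-∷ {c = c} e∉ ap) ((∉σ , tuples-disjoint r c∈) ∷ v) τ∈′

  arr-free : ∀ {es σ τ} → τ ∈ arr es σ → ∣free∣ (used σ) ≡ length es * r + ∣free∣ (used τ)
  arr-free {[]} (here refl) = refl
  arr-free {e ∷ es} {σ} τ∈ with arr-∷⁻ {es = es} {σ} τ∈
  ... | c , c∈ , τ∈′ = trans (tuples-free r c∈)
    (trans (cong (r +_) (arr-free {es} τ∈′)) (sym (+-assoc r (length es * r) _)))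

  arrCount : ℕ → ℕ → ℕ
  arrCount zero    f = 1
  arrCount (suc k) f = fall f r * arrCount k (f ∸ r)

  -- Every tuple takes exactly r free positions, so the past matters only through the number of free
  -- ones. Hence a uniform arrangement is a sequence of uniform choices of tuples.
  length-arr : ∀ es σ → length (arr es σ) ≡ arrCount (length es) (∣free∣ (used σ))
  length-arr [] σ = refl
  length-arr (e ∷ es) σ = begin
    length (arr (e ∷ es) σ)
      ≡⟨ length≡∑ (arr (e ∷ es) σ) ⟩
    ∑ (arr (e ∷ es) σ) (λ _ → 1)
      ≡⟨ ∑-arr-∷ e es σ _ ⟩
    ∑ ts (λ c → ∑ (arr es ((e , c) ∷ σ)) (λ _ → 1))
      ≡⟨ ∑-cong ts (λ {c} c∈ → begin
           ∑ (arr es ((e , c) ∷ σ)) (λ _ → 1)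
             ≡⟨ sym (length≡∑ (arr es ((e , c) ∷ σ))) ⟩
           length (arr es ((e , c) ∷ σ))
             ≡⟨ length-arr es ((e , c) ∷ σ) ⟩
           arrCount (length es) (∣free∣ (c ʳ++ used σ))
             ≡⟨ cong (arrCount (length es)) (sym (trans (cong (_∸ r) (tuples-free r c∈)) (m+n∸m≡n r _))) ⟩
           arrCount (length es) (∣free∣ (used σ) ∸ r) ∎) ⟩
    ∑ ts (λ _ → arrCount (length es) (∣free∣ (used σ) ∸ r))
      ≡⟨ ∑-const ts _ ⟩
    length ts * arrCount (length es) (∣free∣ (used σ) ∸ r)
      ≡⟨ cong (_* arrCount (length es) (∣free∣ (used σ) ∸ r)) (length-tuples r (used σ)) ⟩
    arrCount (length (e ∷ es)) (∣free∣ (used σ)) ∎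
    where
    open ≡-Reasoning
    ts = tuples r (used σ)

  chunk-of : ∀ {x} (σ : State) → x ∈ used σ → ∃ λ e → ∃ λ c → (e , c) ∈ σ × x ∈ c
  chunk-of ((e , c) ∷ σ) x∈ with ∈-ʳ++⁻ c x∈
  ... | inj₁ x∈c = e , c , here refl , x∈c
  ... | inj₂ x∈σ with chunk-of σ x∈σ
  ... | e′ , c′ , ∈σ , x∈c′ = e′ , c′ , there ∈σ , x∈c′

  -- Arrangements consistent with a given word, and the word of an arrangement

  Consistent : Vec (Fin n) m → State → Set
  Consistent w = All (λ (e , c) → All (λ x → lookup w x ≡ e) c)

  consistent? : ∀ w → Decidable (Consistent w)
  consistent? w = all? (λ (e , c) → all? (λ x → lookup w x Fin.≟ e) c)

  consistent-label : ∀ {w σ x} → Consistent w σ → x ∈ used σ → lookup w x ∈ labels σ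
  consistent-label {w} {σ} con x∈ with chunk-of σ x∈
  ... | e , c , ∈σ , x∈c =
    subst (_∈ labels σ) (sym (All.lookup (All.lookup con ∈σ) x∈c)) (∈-map⁺ proj₁ ∈σ)

  occurrences : Vec (Fin n) m → Fin n → ℕ
  occurrences w e = ∑ (allFin m) (λ x → ι (lookup w x Fin.≟ e))

  -- Consistency makes each used position carry the letter of an edge already placed, so all
  -- positions with the fresh letter `e` are still free.
  freeCount-label : ∀ {w e} σ → Consistent w σ → e ∉ labels σ →
    freeCount (λ x → lookup w x Fin.≟ e) (used σ) ≡ occurrences w e
  freeCount-label {w} {e} σ con e∉ = trans (∑-filter _ (allFin m) _)
    (∑-cong (allFin m) (λ {x} _ → indicators x (x ∈? used σ)))
    where
    indicators : ∀ x → Dec (x ∈ used σ) →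
      ι (¬? (x ∈? used σ)) * ι (lookup w x Fin.≟ e) ≡ ι (lookup w x Fin.≟ e)
    indicators x (yes x∈) = trans (cong (ι (¬? (x ∈? used σ)) *_) ≟e) (trans (*-zeroʳ (ι (¬? (x ∈? used σ)))) (sym ≟e))
      where
      ≟e : ι (lookup w x Fin.≟ e) ≡ 0
      ≟e = ι-no (lookup w x Fin.≟ e) (λ eq → e∉ (subst (_∈ labels σ) eq (consistent-label {w} {σ} con x∈)))
    indicators x (no x∉) =
      trans (cong (_* ι (lookup w x Fin.≟ e)) (ι-yes (¬? (x ∈? used σ)) x∉)) (*-identityˡ _)

  -- A consistent tuple for `e` is any ordered r-tuple of distinct positions with letter `e`; tuples
  -- for different letters never compete for a position, so the counts multiply.
  arr-count : ∀ w es σ → Unique es → Apart es σ →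
    ∑ (arr es σ) (λ τ → ι (consistent? w τ))
      ≡ ι (consistent? w σ) * ∏ es (λ e → fall (occurrences w e) r)
  arr-count w [] σ _ _ = trans (+-identityʳ _) (sym (*-identityʳ _))
  arr-count w (e ∷ es) σ (e∉ ∷ u) (∉σ ∷ ap) = begin
    ∑ (arr (e ∷ es) σ) (λ τ → ι (consistent? w τ))
      ≡⟨ ∑-arr-∷ e es σ _ ⟩
    ∑ ts (λ c → ∑ (arr es ((e , c) ∷ σ)) (λ τ → ι (consistent? w τ)))
      ≡⟨ ∑-cong ts (λ {c} _ → trans (arr-count w es ((e , c) ∷ σ) u (apart-∷ {c = c} e∉ ap))
           (trans (cong (_* rest) (trans
             (ι-cong (consistent? w ((e , c) ∷ σ)) (all? has-e? c ×-dec consistent? w σ)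
                     (λ { (p ∷ ps) → p , ps }) (λ { (p , ps) → p ∷ ps }))
             (ι-× (all? has-e? c) (consistent? w σ))))
           (*-assoc (ι (all? has-e? c)) _ rest))) ⟩
    ∑ ts (λ c → ι (all? has-e? c) * (ι (consistent? w σ) * rest))
      ≡⟨ ∑-*ʳ ts (λ c → ι (all? has-e? c)) (ι (consistent? w σ) * rest) ⟩
    ∑ ts (λ c → ι (all? has-e? c)) * (ι (consistent? w σ) * rest)
      ≡⟨ cong (_* (ι (consistent? w σ) * rest)) (tuples-count has-e? r (used σ)) ⟩
    fall (freeCount has-e? (used σ)) r * (ι (consistent? w σ) * rest)
      ≡⟨ to-occurrences (consistent? w σ) ⟩
    fall (occurrences w e) r * (ι (consistent? w σ) * rest)
      ≡⟨ rearrange (fall (occurrences w e) r) (ι (consistent? w σ)) rest ⟩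
    ι (consistent? w σ) * ∏ (e ∷ es) (λ e → fall (occurrences w e) r) ∎
    where
    open ≡-Reasoning
    ts = tuples r (used σ)
    rest = ∏ es (λ e → fall (occurrences w e) r)
    has-e? = λ x → lookup w x Fin.≟ e
    rearrange : ∀ a b c → a * (b * c) ≡ b * (a * c)
    rearrange = solve-∀
    -- Free positions with letter `e` may be replaced by all of them only if `σ` is consistent; if
    -- it is not, both sides vanish.
    to-occurrences : (d : Dec (Consistent w σ)) →
      fall (freeCount has-e? (used σ)) r * (ι d * rest) ≡ fall (occurrences w e) r * (ι d * rest)
    to-occurrences (yes con) = cong (λ z → fall z r * (1 * rest)) (freeCount-label {w} σ con ∉σ)
    to-occurrences (no _) = trans (*-zeroʳ (fall (freeCount has-e? (used σ)) r))
                                  (sym (*-zeroʳ (fall (occurrences w e) r)))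

  -- the letter e₀ is a dummy, read at uncovered positions only
  letter : Fin n → State → Fin m → Fin n
  letter e₀ []            x = e₀
  letter e₀ ((e , c) ∷ σ) x = if does (x ∈? c) then e else letter e₀ σ x

  word : Fin n → State → Vec (Fin n) m
  word e₀ σ = tabulate (letter e₀ σ)

  letter-∈ : ∀ {e₀ e c σ x} → x ∈ c → letter e₀ ((e , c) ∷ σ) x ≡ e
  letter-∈ {e₀} {e} {c} {σ} {x} x∈ =
    cong (λ b → if b then e else letter e₀ σ x) (dec-true (x ∈? c) x∈)

  letter-∉ : ∀ {e₀ e c σ x} → x ∉ c → letter e₀ ((e , c) ∷ σ) x ≡ letter e₀ σ x
  letter-∉ {e₀} {e} {c} {σ} {x} x∉ =
    cong (λ b → if b then e else letter e₀ σ x) (dec-false (x ∈? c) x∉)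

  ∈-used : ∀ {e c σ x} → (e , c) ∈ σ → x ∈ c → x ∈ used σ
  ∈-used {c = c} {σ = (_ , c) ∷ σ} (here refl) x∈ = ∈-ʳ++⁺ˡ c x∈
    where
    ∈-ʳ++⁺ˡ : ∀ {x} (xs : List (Fin m)) {ys} → x ∈ xs → x ∈ xs ʳ++ ys
    ∈-ʳ++⁺ˡ (y ∷ xs) (here refl) = ∈-ʳ++⁺ʳ xs (here refl)
    ∈-ʳ++⁺ˡ (y ∷ xs) (there x∈)  = ∈-ʳ++⁺ˡ xs x∈
  ∈-used {σ = (_ , c) ∷ σ} (there ∈σ) x∈ = ∈-ʳ++⁺ʳ c (∈-used ∈σ x∈)

  letter-chunk : ∀ {e₀ σ e c x} → Valid σ → (e , c) ∈ σ → x ∈ c → letter e₀ σ x ≡ e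
  letter-chunk {σ = (_ , c) ∷ σ} _ (here refl) x∈ = letter-∈ {σ = σ} x∈
  letter-chunk {σ = (_ , c′) ∷ σ} ((_ , dis) ∷ v) (there ∈σ) x∈ =
    trans (letter-∉ {σ = σ} (λ x∈c′ → All.lookup dis x∈c′ (∈-used ∈σ x∈))) (letter-chunk v ∈σ x∈)

  word-consistent : ∀ {e₀ σ} → Valid σ → Consistent (word e₀ σ) σ
  word-consistent {e₀} {σ} v = All.tabulate λ ∈σ → All.tabulate λ {x} x∈ →
    trans (V.lookup∘tabulate (letter e₀ σ) x) (letter-chunk v ∈σ x∈)

  -- Full cover keeps the dummy letter from being read anywhere, so every letter of `w` is dictated
  -- by the tuple through its position.
  consistent⇒≡word : ∀ {e₀ σ w} → (∀ x → x ∈ used σ) → Valid σ → Consistent w σ → w ≡ word e₀ σ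
  consistent⇒≡word {e₀} {σ} {w} cover v con = begin
    w                     ≡⟨ sym (V.tabulate∘lookup w) ⟩
    tabulate (lookup w)   ≡⟨ V.tabulate-cong agree ⟩
    word e₀ σ             ∎
    where
    open ≡-Reasoning
    agree : ∀ x → lookup w x ≡ letter e₀ σ x
    agree x with chunk-of σ (cover x)
    ... | e , c , ∈σ , x∈c =
      trans (All.lookup (All.lookup con ∈σ) x∈c) (sym (letter-chunk v ∈σ x∈c))

-- Expresses that `allVecs` lists each word exactly once, in the shape that collapses the inner sum
-- of the double count.
∑-allVecs-point : ∀ {n} k (w₀ : Vec (Fin n) k) (f : Vec (Fin n) k → ℕ) →
  ∑ (allVecs (allFin n) k) (λ w → ι (V.≡-dec Fin._≟_ w w₀) * f w) ≡ f w₀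
∑-allVecs-point zero V.[] f = trans (+-identityʳ _) (*-identityˡ _)
∑-allVecs-point {n} (suc k) (a V.∷ w₀) f = begin
  ∑ (allVecs (allFin n) (suc k)) (λ w → ι (V.≡-dec Fin._≟_ w (a V.∷ w₀)) * f w)
    ≡⟨ ∑-concatMap _ (allFin n) _ ⟩
  ∑ (allFin n) (λ x → ∑ (map (x V.∷_) ws) (λ w → ι (V.≡-dec Fin._≟_ w (a V.∷ w₀)) * f w))
    ≡⟨ ∑-cong (allFin n) (λ {x} _ → begin
         ∑ (map (x V.∷_) ws) (λ w → ι (V.≡-dec Fin._≟_ w (a V.∷ w₀)) * f w)
           ≡⟨ ∑-map (x V.∷_) ws _ ⟩
         ∑ ws (λ w → ι (V.≡-dec Fin._≟_ (x V.∷ w) (a V.∷ w₀)) * f (x V.∷ w))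
           ≡⟨ ∑-cong ws (λ {w} _ → trans (cong (_* f (x V.∷ w)) (split x w))
                                         (*-assoc (ι (x Fin.≟ a)) _ _)) ⟩
         ∑ ws (λ w → ι (x Fin.≟ a) * (ι (V.≡-dec Fin._≟_ w w₀) * f (x V.∷ w)))
           ≡⟨ ∑-*ˡ ws (ι (x Fin.≟ a)) _ ⟩
         ι (x Fin.≟ a) * ∑ ws (λ w → ι (V.≡-dec Fin._≟_ w w₀) * f (x V.∷ w))
           ≡⟨ cong (ι (x Fin.≟ a) *_) (∑-allVecs-point k w₀ (f ∘ (x V.∷_))) ⟩
         ι (x Fin.≟ a) * f (x V.∷ w₀) ∎) ⟩
  ∑ (allFin n) (λ x → ι (x Fin.≟ a) * f (x V.∷ w₀))
    ≡⟨ ∑-allFin-point _ a ⟩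
  f (a V.∷ w₀) ∎
  where
  open ≡-Reasoning
  ws = allVecs (allFin n) k
  split : ∀ x w → ι (V.≡-dec Fin._≟_ (x V.∷ w) (a V.∷ w₀)) ≡ ι (x Fin.≟ a) * ι (V.≡-dec Fin._≟_ w w₀)
  split x w = trans
    (ι-cong (V.≡-dec Fin._≟_ (x V.∷ w) (a V.∷ w₀)) (x Fin.≟ a ×-dec V.≡-dec Fin._≟_ w w₀)
            V.∷-injective (λ { (refl , refl) → refl }))
    (ι-× (x Fin.≟ a) (V.≡-dec Fin._≟_ w w₀))

length-filterᵇ : (f : A → Bool) (xs : List A) → length (filterᵇ f xs) ≡ ∑ xs (λ x → ι (T? (f x)))
length-filterᵇ f xs = trans (length≡∑ (filterᵇ f xs))
  (trans (∑-filter (T? ∘ f) xs (λ _ → 1)) (∑-cong xs (λ _ → *-identityʳ _)))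

ι-T? : (p : Dec P) → ι (T? ⌊ p ⌋) ≡ ι p
ι-T? (yes _) = refl
ι-T? (no _)  = refl

∑-allFin-suc : ∀ {k} (f : Fin (suc k) → ℕ) → ∑ (allFin (suc k)) f ≡ f F.zero + ∑ (allFin k) (f ∘ F.suc)
∑-allFin-suc {k} f = cong (f F.zero +_)
  (trans (cong (λ xs → ∑ xs f) (sym (map-tabulate id F.suc))) (∑-map F.suc (allFin k) f))

length-allFin : ∀ k → length (allFin k) ≡ k
length-allFin k = length-tabulate {n = k} id

∑-toList : ∀ {k} (w : Vec A k) (f : A → ℕ) → ∑ (toList w) f ≡ ∑ (allFin k) (λ x → f (lookup w x))
∑-toList V.[] f = refl
∑-toList (a V.∷ w) f = trans (cong (f a +_) (∑-toList w f)) (sym (∑-allFin-suc (λ x → f (lookup (a V.∷ w) x))))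

∏-const : (xs : List A) {f : A → ℕ} (k : ℕ) → (∀ {x} → x ∈ xs → f x ≡ k) → ∏ xs f ≡ k ^ length xs
∏-const [] k eq = refl
∏-const (x ∷ xs) k eq = cong₂ _*_ (eq (here refl)) (∏-const xs k (eq ∘ there))

∏-zero : {xs : List A} {f : A → ℕ} {x : A} → x ∈ xs → f x ≡ 0 → ∏ xs f ≡ 0
∏-zero {xs = _ ∷ xs} {f} (here refl) eq = cong (_* ∏ xs f) eq
∏-zero {xs = y ∷ _} {f} (there x∈) eq = trans (cong (f y *_) (∏-zero x∈ eq)) (*-zeroʳ (f y))

-- Double counting of matchings and arrangements

module Counting (r n : ℕ) where

  open Arrangements {r * n} {n} r public

  arrangements : List State
  arrangements = arr (allFin n) []

  words : List (Vec (Fin n) (r * n))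
  words = allVecs (allFin n) (r * n)

  occ≡occurrences : ∀ (w : Vec (Fin n) (r * n)) e → occ w e ≡ occurrences w e
  occ≡occurrences w e = trans (length-filterᵇ _ (toList w))
    (trans (∑-cong (toList w) (λ {x} _ → ι-T? (x Fin.≟ e))) (∑-toList w (λ x → ι (x Fin.≟ e))))

  ∑-occurrences : ∀ w → ∑ (allFin n) (occurrences w) ≡ r * n
  ∑-occurrences w = begin
    ∑ (allFin n) (occurrences w)
      ≡⟨ ∑-swap (allFin n) (allFin (r * n)) _ ⟩
    ∑ (allFin (r * n)) (λ x → ∑ (allFin n) (λ e → ι (lookup w x Fin.≟ e)))
      ≡⟨ ∑-cong (allFin (r * n)) (λ {x} _ → trans
           (∑-cong (allFin n) (λ {e} _ → trans
             (ι-cong (lookup w x Fin.≟ e) (e Fin.≟ lookup w x) sym sym) (sym (*-identityʳ _))))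
           (∑-allFin-point (λ _ → 1) (lookup w x))) ⟩
    ∑ (allFin (r * n)) (λ _ → 1)
      ≡⟨ sym (length≡∑ (allFin (r * n))) ⟩
    length (allFin (r * n))
      ≡⟨ length-allFin (r * n) ⟩
    r * n ∎
    where open ≡-Reasoning

  matching-occ : ∀ {w} → T (isMatchingᵇ r n w) → ∀ e → occurrences w e ≡ r
  matching-occ {w} mat e = trans (sym (occ≡occurrences w e))
    (toWitness (All.lookup (all⁺ (λ i → ⌊ occ w i ℕ.≟ r ⌋) (allFin n) mat) (∈-allFin e)))

  -- The multiplicity with which a labelled matching arises: the r positions of each of the n edges
  -- can be listed in r! orders.
  ∏-matching : ∀ {w} → T (isMatchingᵇ r n w) → ∏ (allFin n) (λ e → fall (occurrences w e) r) ≡ (r !) ^ n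
  ∏-matching {w} mat = trans
    (∏-const (allFin n) (r !) (λ {e} _ → trans (cong (λ z → fall z r) (matching-occ {w} mat e)) (fall-self r)))
    (cong ((r !) ^_) (length-allFin n))

  -- When all terms are at least r, a total of at most r per term leaves none of them any slack.
  ∑-all-≥ : (xs : List A) {f : A → ℕ} → ∑ xs f ≤ r * length xs → All (λ x → r ≤ f x) xs →
    All (λ x → f x ≡ r) xs
  ∑-all-≥ [] _ _ = []
  ∑-all-≥ (x ∷ xs) {f} le (r≤ ∷ rs) = ≤-antisym fx≤r r≤ ∷ ∑-all-≥ xs tail≤ rs
    where
    lower : All (λ x → r ≤ f x) xs → r * length xs ≤ ∑ xs f
    lower rs = ≤-trans (≤-reflexive (trans (*-comm r _) (sym (∑-const xs r)))) (∑-mono xs (All.lookup rs))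
    le′ : f x + ∑ xs f ≤ r + r * length xs
    le′ = ≤-trans le (≤-reflexive (*-suc r (length xs)))
    fx≤r : f x ≤ r
    fx≤r = +-cancelʳ-≤ _ _ _ (≤-trans (+-monoʳ-≤ (f x) (lower rs)) le′)
    tail≤ : ∑ xs f ≤ r * length xs
    tail≤ = +-cancelˡ-≤ _ _ _ (≤-trans (+-monoˡ-≤ (∑ xs f) r≤) le′)

  -- the letter counts add up to r n, so a word that is not a matching has a letter occurring
  -- fewer than r times
  ∏-occ-≤ : ∀ w → ∏ (allFin n) (λ e → fall (occurrences w e) r) ≤ ι (T? (isMatchingᵇ r n w)) * (r !) ^ n
  ∏-occ-≤ w with T? (isMatchingᵇ r n w)
  ... | yes mat = ≤-reflexive (trans (∏-matching {w} mat) (sym (*-identityˡ _)))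
  ... | no ¬mat with all? (λ e → r ℕ.≤? occurrences w e) (allFin n)
  ...   | yes ge = contradiction
            (all⁻ (λ i → ⌊ occ w i ℕ.≟ r ⌋) (All.map (λ {e} eq → fromWitness (trans (occ≡occurrences w e) eq))
              (∑-all-≥ (allFin n) (≤-reflexive (trans (∑-occurrences w) (cong (r *_) (sym (length-allFin n))))) ge)))
            ¬mat
  ...   | no ¬ge with find (¬All⇒Any¬ (λ e → r ℕ.≤? occurrences w e) (allFin n) ¬ge)
  ...     | e , e∈ , r≰ = ≤-reflexive (∏-zero e∈ (fall-zero (≰⇒> r≰)))

  arrangement-valid : ∀ {τ} → τ ∈ arrangements → Valid τ
  arrangement-valid = arr-valid (allFin⁺ n) (All.tabulate λ _ ()) []

  ∣free∣-[] : ∣free∣ {r * n} [] ≡ r * n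
  ∣free∣-[] = trans (length≡∑ (free {r * n} [])) (trans (∑-filter (λ x → ¬? (x ∈? [])) (allFin (r * n)) (λ _ → 1))
    (trans (sym (length≡∑ (allFin (r * n)))) (length-allFin (r * n))))

  arrangement-covers : ∀ {τ} → τ ∈ arrangements → ∀ x → x ∈ used τ
  arrangement-covers {τ} τ∈ = ∣free∣≡0⇒∈ (+-cancelˡ-≡ (r * n) _ _ (begin
    r * n + ∣free∣ (used τ)                     ≡⟨ cong (_+ ∣free∣ (used τ)) (*-comm r n) ⟩
    n * r + ∣free∣ (used τ)                     ≡⟨ cong (λ z → z * r + ∣free∣ (used τ)) (sym (length-allFin n)) ⟩
    length (allFin n) * r + ∣free∣ (used τ)     ≡⟨ sym (arr-free {allFin n} τ∈) ⟩
    ∣free∣ {r * n} []                           ≡⟨ ∣free∣-[] ⟩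
    r * n                                       ≡⟨ sym (+-identityʳ _) ⟩
    r * n + 0                                   ∎))
    where open ≡-Reasoning

  -- double counting of the consistent pairs (w , τ): an arrangement determines its word
  word-count : (e₀ : Fin n) (f : Vec (Fin n) (r * n) → ℕ) →
    ∑ words (λ w → f w * ∏ (allFin n) (λ e → fall (occurrences w e) r))
      ≡ ∑ arrangements (λ τ → f (word e₀ τ))
  word-count e₀ f = begin
    ∑ words (λ w → f w * ∏ (allFin n) (λ e → fall (occurrences w e) r))
      ≡⟨ ∑-cong words (λ {w} _ → trans
           (cong (f w *_) (sym (trans (arr-count w (allFin n) [] (allFin⁺ n) (All.tabulate λ _ ())) (*-identityˡ _))))
           (sym (∑-*ˡ arrangements (f w) _))) ⟩
    ∑ words (λ w → ∑ arrangements (λ τ → f w * ι (consistent? w τ)))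
      ≡⟨ ∑-swap words arrangements _ ⟩
    ∑ arrangements (λ τ → ∑ words (λ w → f w * ι (consistent? w τ)))
      ≡⟨ ∑-cong arrangements (λ {τ} τ∈ → trans
           (∑-cong words (λ {w} _ → trans
             (cong (f w *_) (ι-cong (consistent? w τ) (V.≡-dec Fin._≟_ w (word e₀ τ))
               (consistent⇒≡word (arrangement-covers τ∈) (arrangement-valid τ∈))
               (λ { refl → word-consistent (arrangement-valid τ∈) })))
             (*-comm (f w) _)))
           (∑-allVecs-point (r * n) (word e₀ τ) f)) ⟩
    ∑ arrangements (λ τ → f (word e₀ τ)) ∎
    where open ≡-Reasoning

  -- `word-count` with the constant 1 counts all arrangements; by `∏-occ-≤` words that are not
  -- matchings contribute nothing.
  arrangements≤matchings : Fin n → length arrangements ≤ numMatchings r n * (r !) ^ n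
  arrangements≤matchings e₀ = begin
    length arrangements
      ≡⟨ length≡∑ arrangements ⟩
    ∑ arrangements (λ _ → 1)
      ≡⟨ sym (word-count e₀ (λ _ → 1)) ⟩
    ∑ words (λ w → 1 * ∏ (allFin n) (λ e → fall (occurrences w e) r))
      ≤⟨ ∑-mono words (λ {w} _ → ≤-trans (≤-reflexive (*-identityˡ _)) (∏-occ-≤ w)) ⟩
    ∑ words (λ w → ι (T? (isMatchingᵇ r n w)) * (r !) ^ n)
      ≡⟨ ∑-*ʳ words (λ w → ι (T? (isMatchingᵇ r n w))) _ ⟩
    ∑ words (λ w → ι (T? (isMatchingᵇ r n w))) * (r !) ^ n
      ≡⟨ cong (_* (r !) ^ n) (sym (length-filterᵇ (isMatchingᵇ r n) words)) ⟩
    numMatchings r n * (r !) ^ n ∎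
    where open ≤-Reasoning

-- Insertion into a list sorted by block

insert : A × ℕ → List (A × ℕ) → List (A × ℕ)
insert p []      = p ∷ []
insert p (q ∷ H) with proj₂ p ℕ.<? proj₂ q
... | yes _ = p ∷ q ∷ H
... | no _  = q ∷ insert p H

length-insert : (p : A × ℕ) (H : List (A × ℕ)) → length (insert p H) ≡ suc (length H)
length-insert p []      = refl
length-insert p (q ∷ H) with proj₂ p ℕ.<? proj₂ q
... | yes _ = refl
... | no _  = cong suc (length-insert p H)

insert-All : {R : A × ℕ → Set} {p : A × ℕ} (H : List (A × ℕ)) → R p → All R H → All R (insert p H)
insert-All []      rp []        = rp ∷ []
insert-All {p = p} (q ∷ H) rp (rq ∷ rs) with proj₂ p ℕ.<? proj₂ q
... | yes _ = rp ∷ rq ∷ rs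
... | no _  = rq ∷ insert-All H rp rs

Sorted : List (A × ℕ) → Set
Sorted = AllPairs (λ p q → proj₂ p < proj₂ q)

insert-Sorted : {p : A × ℕ} (H : List (A × ℕ)) → proj₂ p ∉ map proj₂ H → Sorted H → Sorted (insert p H)
insert-Sorted []      _  [] = [] ∷ []
insert-Sorted {p = p} (q ∷ H) p∉ (q< ∷ s) with proj₂ p ℕ.<? proj₂ q
... | yes p<q = (p<q ∷ All.map (<-trans p<q) q<) ∷ q< ∷ s
-- The block of `p` is new, so the failed test yields a strict inequality in the other direction.
... | no p≮q  =
  insert-All H (≤∧≢⇒< (≮⇒≥ p≮q) (p∉ ∘ here ∘ sym)) q< ∷ insert-Sorted H (p∉ ∘ there) s

∈-allVecs : ∀ {n k} (w : Vec (Fin n) k) → w ∈ allVecs (allFin n) k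
∈-allVecs V.[] = here refl
∈-allVecs {n} (a V.∷ w) =
  ∈-concatMap⁺ _ (Any.map (λ { refl → ∈-map⁺ (a V.∷_) (∈-allVecs w) }) (∈-allFin a))

T-implies : (p : Dec A) (q : Dec B) (s : Dec P) → (A → B → P) → T (not (⌊ p ⌋ ∧ ⌊ q ⌋) ∨ ⌊ s ⌋)
T-implies (yes a) (yes b) (yes _) f = tt
T-implies (yes a) (yes b) (no ¬s) f = ¬s (f a b)
T-implies (yes _) (no _)  _       f = tt
T-implies (no _)  _       _       f = tt

-- Blocks and hits

module Hits {r n : ℕ} (blk : Fin (r * n) → ℕ) (blk-mono : ∀ {p q} → blk p < blk q → toℕ p < toℕ q) where

  open Counting r n

  Hit : List (Fin n × ℕ) → List (Fin (r * n)) → Set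
  Hit H []      = ⊥
  Hit H (x ∷ c) = blk x ∉ map proj₂ H × All (λ y → blk y ≡ blk x) c

  hit? : ∀ H c → Dec (Hit H c)
  hit? H []      = no id
  hit? H (x ∷ c) = ¬? (blk x ∈ℕ? map proj₂ H) ×-dec all? (λ y → blk y ℕ.≟ blk x) c

  extend : List (Fin n × ℕ) → Fin n → List (Fin (r * n)) → List (Fin n × ℕ)
  extend H e []      = H
  extend H e (x ∷ c) with hit? H (x ∷ c)
  ... | yes _ = insert (e , blk x) H
  ... | no _  = H

  -- Hits occur in an arbitrary order in time; since `extend` inserts by block, the list reads from
  -- left to right and its edges form a line.
  hits : State → List (Fin n × ℕ)
  hits []            = []
  hits ((e , c) ∷ σ) = extend (hits σ) e c

  length-extend : ∀ H e c → length (extend H e c) ≡ ι (hit? H c) + length H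
  length-extend H e []      = refl
  length-extend H e (x ∷ c) with hit? H (x ∷ c)
  ... | yes _ = length-insert (e , blk x) H
  ... | no _  = refl

  hits-Sorted : ∀ σ → Sorted (hits σ)
  hits-Sorted [] = []
  hits-Sorted ((e , []) ∷ σ) = hits-Sorted σ
  hits-Sorted ((e , x ∷ c) ∷ σ) with hit? (hits σ) (x ∷ c)
  ... | yes (x∉ , _) = insert-Sorted (hits σ) x∉ (hits-Sorted σ)
  ... | no _         = hits-Sorted σ

  InBlock : State → Fin n × ℕ → Set
  InBlock σ (e , b) = ∃ λ c → (e , c) ∈ σ × All (λ y → blk y ≡ b) c

  hits-InBlock : ∀ σ → All (InBlock σ) (hits σ)
  hits-InBlock [] = []
  hits-InBlock ((e , []) ∷ σ) = All.map (λ (c , ∈σ , b) → c , there ∈σ , b) (hits-InBlock σ)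
  hits-InBlock ((e , x ∷ c) ∷ σ) with hit? (hits σ) (x ∷ c)
  ... | yes (_ , same) = insert-All (hits σ) (x ∷ c , here refl , refl ∷ same)
          (All.map (λ (c , ∈σ , b) → c , there ∈σ , b) (hits-InBlock σ))
  ... | no _ = All.map (λ (c , ∈σ , b) → c , there ∈σ , b) (hits-InBlock σ)

  length-hits : ∀ σ → length (hits σ) ≤ length σ
  length-hits [] = z≤n
  length-hits ((e , c) ∷ σ) = ≤-trans (≤-reflexive (length-extend (hits σ) e c))
    (+-mono-≤ (ι≤1 (hit? (hits σ) c)) (length-hits σ))

  length-state : ∀ {es σ τ} → τ ∈ arr es σ → length τ ≡ length es + length σ
  length-state {[]} (here refl) = refl
  length-state {e ∷ es} {σ} τ∈ with arr-∷⁻ {es = es} {σ} τ∈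
  ... | c , _ , τ∈′ = trans (length-state {es} τ∈′) (+-suc (length es) (length σ))

  chunk-unique : ∀ {σ e c c′} → Valid σ → (e , c) ∈ σ → (e , c′) ∈ σ → c ≡ c′
  chunk-unique _ (here refl) (here refl) = refl
  chunk-unique ((e∉ , _) ∷ _) (here refl) (there ∈σ) = contradiction (∈-map⁺ proj₁ ∈σ) e∉
  chunk-unique ((e∉ , _) ∷ _) (there ∈σ) (here refl) = contradiction (∈-map⁺ proj₁ ∈σ) e∉
  chunk-unique (_ ∷ v) (there ∈σ) (there ∈σ′) = chunk-unique v ∈σ ∈σ′

  Confined : Vec (Fin n) (r * n) → Fin n × ℕ → Set
  Confined w (e , b) = ∀ p → lookup w p ≡ e → blk p ≡ b

  -- Passes from tuples to letters. Every position is covered and an edge has a single tuple, so a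
  -- position showing `e` lies in the tuple of `e`; at an uncovered position the dummy letter could
  -- take an edge out of its block.
  hits-Confined : ∀ {e₀ σ} → Valid σ → (∀ x → x ∈ used σ) → All (Confined (word e₀ σ)) (hits σ)
  hits-Confined {e₀} {σ} v cover = All.map confined (hits-InBlock σ)
    where
    confined : ∀ {p} → InBlock σ p → Confined (word e₀ σ) p
    confined (c , ∈σ , same) p eq with chunk-of σ (cover p)
    ... | e′ , c′ , ∈σ′ , p∈ with trans (sym (All.lookup (All.lookup (word-consistent v) ∈σ′) p∈)) eq
    ... | refl with chunk-unique v ∈σ ∈σ′
    ... | refl = All.lookup same p∈

  edgeBefore : ∀ {w a b i j} → i < j → Confined w (a , i) → Confined w (b , j) → T (edgeBeforeᵇ w a b)
  edgeBefore {w} {a} {b} i<j ca cb =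
    all⁻ (λ p → all (ordered p) (allFin (r * n))) (All.tabulate {xs = allFin (r * n)} λ {p} _ →
      all⁻ (ordered p) (All.tabulate {xs = allFin (r * n)} λ {q} _ →
        T-implies (lookup w p Fin.≟ a) (lookup w q Fin.≟ b) (toℕ p ℕ.<? toℕ q) λ wp wq →
          blk-mono (subst₂ _<_ (sym (ca p wp)) (sym (cb q wq)) i<j)))
    where
    ordered : Fin (r * n) → Fin (r * n) → Bool
    ordered p q = not (⌊ lookup w p Fin.≟ a ⌋ ∧ ⌊ lookup w q Fin.≟ b ⌋) ∨ ⌊ toℕ p ℕ.<? toℕ q ⌋

  Sorted⇒line : ∀ {w} H → Sorted H → All (Confined w) H → T (isLineᵇ w (map proj₁ H))
  Sorted⇒line []          _  _  = tt
  Sorted⇒line (p ∷ [])    _  _  = tt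
  Sorted⇒line {w} (p ∷ q ∷ H) ((p<q ∷ _) ∷ s) (cp ∷ cq ∷ cs) = Equivalence.from T-∧
    (edgeBefore {w} p<q cp cq , Sorted⇒line (q ∷ H) s (cq ∷ cs))

  isLine⇒hasLine : ∀ (w : Vec (Fin n) (r * n)) ℓ → T (isLineᵇ w ℓ) → T (hasLineᵇ w (length ℓ))
  isLine⇒hasLine w ℓ line = any⁺ _
    (lose (∈-allVecs (fromList ℓ)) (subst (T ∘ isLineᵇ w) (sym (V.toList∘fromList ℓ)) line))

  arrangement-largeLine : ∀ {e₀ τ} a b → τ ∈ arrangements → a * n ≤ b * length (hits τ) ^ r →
    T (hasLargeLineᵇ r a b n (word e₀ τ))
  arrangement-largeLine {e₀} {τ} a b τ∈ le = any⁺ _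
    (lose (∈-upTo⁺ (s≤s k≤n)) (Equivalence.from T-∧ (fromWitness le , line)))
    where
    -- `hasLargeLineᵇ` searches sizes up to n only; each of the n edges yields at most one hit.
    k≤n : length (hits τ) ≤ n
    k≤n = ≤-trans (length-hits τ) (≤-reflexive (trans (length-state {allFin n} τ∈)
            (trans (+-identityʳ _) (length-allFin n))))
    line : T (hasLineᵇ (word e₀ τ) (length (hits τ)))
    line = subst (T ∘ hasLineᵇ (word e₀ τ)) (length-map proj₁ (hits τ))
      (isLine⇒hasLine (word e₀ τ) (map proj₁ (hits τ))
        (Sorted⇒line (hits τ) (hits-Sorted τ)
          (hits-Confined (arrangement-valid τ∈) (arrangement-covers τ∈))))

-- The truncated exponential weight, the frequency of hits and the decay

∑-filter-≤ : {P : A → Set} (P? : ∀ x → Dec (P x)) (xs : List A) (f : A → ℕ) →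
  ∑ (filter P? xs) f ≤ ∑ xs f
∑-filter-≤ P? xs f = ≤-trans (≤-reflexive (∑-filter P? xs f))
  (∑-mono xs (λ {x} _ → ≤-trans (*-monoˡ-≤ (f x) (ι≤1 (P? x))) (≤-reflexive (*-identityˡ _))))

-- This is 2^d except for the value 0 at d = 0, where truncated subtraction sends all states with
-- the target number of hits or more. One more hit at least halves it, the last one taking it from 2
-- to 0.
gap : ℕ → ℕ
gap zero    = 0
gap (suc d) = 2 ^ suc d

gap-pred : ∀ d → 2 * gap (pred d) ≤ gap d
gap-pred zero          = z≤n
gap-pred (suc zero)    = z≤n
gap-pred (suc (suc d)) = ≤-refl

gap≤2^ : ∀ d → gap d ≤ 2 ^ d
gap≤2^ zero    = z≤n
gap≤2^ (suc d) = ≤-refl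

gap>0 : ∀ {d} → 0 < d → 0 < gap d
gap>0 {suc d} _ = m^n>0 2 (suc d)

module Decay
  {r′ n : ℕ} (blk : Fin (suc r′ * n) → ℕ) (blk-mono : ∀ {p q} → blk p < blk q → toℕ p < toℕ q)
  (B L : ℕ) (blk<B : ∀ x → blk x < B)
  (blk-size : ∀ b → ∑ (allFin (suc r′ * n)) (λ x → ι (blk x ℕ.≟ b)) ≤ L)
  where

  private
    r = suc r′
    m = suc r′ * n

  open Counting r n
  open Hits {r} {n} blk blk-mono

  inBlock : List (Fin m) → ℕ → ℕ
  inBlock us b = freeCount (λ y → blk y ℕ.≟ b) us

  hit-blocks-size : (H : List ℕ) → ∑ (allFin m) (λ x → ι (blk x ∈ℕ? H)) ≤ length H * L
  hit-blocks-size H = begin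
    ∑ (allFin m) (λ x → ι (blk x ∈ℕ? H))
      ≤⟨ ∑-mono (allFin m) (λ {x} _ → union x (blk x ∈ℕ? H)) ⟩
    ∑ (allFin m) (λ x → ∑ H (λ b → ι (blk x ℕ.≟ b)))
      ≡⟨ ∑-swap (allFin m) H _ ⟩
    ∑ H (λ b → ∑ (allFin m) (λ x → ι (blk x ℕ.≟ b)))
      ≤⟨ ∑-mono H (λ {b} _ → blk-size b) ⟩
    ∑ H (λ _ → L)
      ≡⟨ ∑-const H L ⟩
    length H * L ∎
    where
    open ≤-Reasoning
    union : ∀ x (d : Dec (blk x ∈ H)) → ι d ≤ ∑ H (λ b → ι (blk x ℕ.≟ b))
    union x (yes x∈) = ≤-trans (≤-reflexive (sym (ι-yes (blk x ℕ.≟ blk x) refl)))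
                               (term≤∑ (λ b → ι (blk x ℕ.≟ b)) x∈)
    union x (no _)   = z≤n

  -- Grouped by block: a sparse block contributes fewer than q positions, any other block none.
  sparse-size : ∀ q us → ∑ (free us) (λ x → ι (inBlock us (blk x) ℕ.<? q)) ≤ B * q
  sparse-size q us = begin
    ∑ (free us) (λ x → ι (inBlock us (blk x) ℕ.<? q))
      ≤⟨ ∑-mono (free us) (λ {x} _ → ≤-trans
           (≤-reflexive (sym (trans (cong (_* ι (sparse? (blk x))) (ι-yes (blk x ℕ.≟ blk x) refl)) (*-identityˡ _))))
           (term≤∑ (λ b → ι (blk x ℕ.≟ b) * ι (sparse? b)) (∈-upTo⁺ (blk<B x)))) ⟩
    ∑ (free us) (λ x → ∑ (upTo B) (λ b → ι (blk x ℕ.≟ b) * ι (sparse? b)))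
      ≡⟨ ∑-swap (free us) (upTo B) _ ⟩
    ∑ (upTo B) (λ b → ∑ (free us) (λ x → ι (blk x ℕ.≟ b) * ι (sparse? b)))
      ≡⟨ ∑-cong (upTo B) (λ {b} _ → ∑-*ʳ (free us) (λ x → ι (blk x ℕ.≟ b)) _) ⟩
    ∑ (upTo B) (λ b → inBlock us b * ι (sparse? b))
      ≤⟨ ∑-mono (upTo B) (λ {b} _ → small b (sparse? b)) ⟩
    ∑ (upTo B) (λ _ → q)
      ≡⟨ trans (∑-const (upTo B) q) (cong (_* q) (length-upTo B)) ⟩
    B * q ∎
    where
    open ≤-Reasoning
    sparse? : ∀ b → Dec (inBlock us b < q)
    sparse? b = inBlock us b ℕ.<? q
    small : ∀ b (d : Dec (inBlock us b < q)) → inBlock us b * ι d ≤ q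
    small b (yes lt) = ≤-trans (≤-reflexive (*-identityʳ _)) (<⇒≤ lt)
    small b (no _)   = ≤-trans (≤-reflexive (*-zeroʳ (inBlock us b))) z≤n

  hitCount : List (Fin n × ℕ) → List (Fin m) → ℕ
  hitCount H us = ∑ (tuples r us) (λ c → ι (hit? H c))

  -- g counts the free positions in unhit blocks with at least a + r free positions:
  -- each of them starts at least a ^ r′ hits
  hitCount-≥ : ∀ a H us → ∃ λ g →
    ∣free∣ us ≤ g + length H * L + B * (a + r) × g * a ^ r′ ≤ hitCount H us
  hitCount-≥ a H us = g , free-≤ , hits-≥
    where
    open ≤-Reasoning
    q = a + r
    unhit? : ∀ x → Dec (blk x ∉ map proj₂ H)
    unhit? x = ¬? (blk x ∈ℕ? map proj₂ H)
    roomy? : ∀ x → Dec (q ≤ inBlock us (blk x))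
    roomy? x = q ℕ.≤? inBlock us (blk x)
    hitBlock sparse : Fin m → ℕ
    hitBlock x = ι (blk x ∈ℕ? map proj₂ H)
    sparse x   = ι (inBlock us (blk x) ℕ.<? q)
    g = ∑ (free us) (λ x → ι (unhit? x) * ι (roomy? x))
    cases : ∀ x → 1 ≤ ι (unhit? x) * ι (roomy? x) + hitBlock x + sparse x
    cases x with blk x ∈ℕ? map proj₂ H
    ... | yes _ = s≤s z≤n
    ... | no _ with q ℕ.≤? inBlock us (blk x)
    ...   | yes _  = s≤s z≤n
    ...   | no q≰  = ≤-reflexive (sym (ι-yes (inBlock us (blk x) ℕ.<? q) (≰⇒> q≰)))
    free-≤ : ∣free∣ us ≤ g + length H * L + B * q
    free-≤ = begin
      ∣free∣ us
        ≡⟨ length≡∑ (free us) ⟩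
      ∑ (free us) (λ _ → 1)
        ≤⟨ ∑-mono (free us) (λ {x} _ → cases x) ⟩
      ∑ (free us) (λ x → ι (unhit? x) * ι (roomy? x) + hitBlock x + sparse x)
        ≡⟨ trans (∑-+ (free us) _ sparse) (cong (_+ ∑ (free us) sparse) (∑-+ (free us) _ hitBlock)) ⟩
      g + ∑ (free us) hitBlock + ∑ (free us) sparse
        ≤⟨ +-mono-≤ (+-monoʳ-≤ g (≤-trans (∑-filter-≤ _ (allFin m) hitBlock)
             (hit-blocks-size (map proj₂ H)))) (sparse-size q us) ⟩
      g + length (map proj₂ H) * L + B * q
        ≡⟨ cong (λ z → g + z * L + B * q) (length-map proj₂ H) ⟩
      g + length H * L + B * q ∎
    inBlock-∷ : ∀ {x} → x ∈ free us → inBlock us (blk x) ≡ suc (inBlock (x ∷ us) (blk x))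
    inBlock-∷ {x} x∈ = trans (∑-free-∷ (λ y → ι (blk y ℕ.≟ blk x)) x∈)
      (cong (_+ inBlock (x ∷ us) (blk x)) (ι-yes (blk x ℕ.≟ blk x) refl))
    -- With `x` taken, the block keeps at least a + r - 1 = a + `r′` free positions, the amount
    -- `^≤fall` asks for to complete the tuple.
    roomy⇒ : ∀ {x} → x ∈ free us → (d : Dec (q ≤ inBlock us (blk x))) →
      ι d * a ^ r′ ≤ fall (inBlock (x ∷ us) (blk x)) r′
    roomy⇒ x∈ (no _) = z≤n
    roomy⇒ {x} x∈ (yes q≤) = ≤-trans (≤-reflexive (*-identityˡ _)) (^≤fall a r′ (ℕ.s≤s⁻¹
      (≤-trans (≤-reflexive (sym (+-suc a r′))) (≤-trans q≤ (≤-reflexive (inBlock-∷ x∈))))))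
    hits-≥ : g * a ^ r′ ≤ hitCount H us
    hits-≥ = begin
      g * a ^ r′
        ≡⟨ sym (∑-*ʳ (free us) (λ x → ι (unhit? x) * ι (roomy? x)) (a ^ r′)) ⟩
      ∑ (free us) (λ x → ι (unhit? x) * ι (roomy? x) * a ^ r′)
        ≤⟨ ∑-mono (free us) (λ {x} x∈ → ≤-trans (≤-reflexive (*-assoc (ι (unhit? x)) _ _))
             (*-monoʳ-≤ (ι (unhit? x)) (roomy⇒ x∈ (roomy? x)))) ⟩
      ∑ (free us) (λ x → ι (unhit? x) * fall (inBlock (x ∷ us) (blk x)) r′)
        ≡⟨ ∑-cong (free us) (λ {x} _ → sym (trans
             (∑-cong (tuples r′ (x ∷ us)) (λ {c} _ → ι-× (unhit? x) (all? (λ y → blk y ℕ.≟ blk x) c)))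
             (trans (∑-*ˡ (tuples r′ (x ∷ us)) (ι (unhit? x)) _)
                    (cong (ι (unhit? x) *_) (tuples-count (λ y → blk y ℕ.≟ blk x) r′ (x ∷ us)))))) ⟩
      ∑ (free us) (λ x → ∑ (tuples r′ (x ∷ us)) (λ c → ι (hit? H (x ∷ c))))
        ≡⟨ sym (∑-tuples-suc r′ us (λ c → ι (hit? H c))) ⟩
      hitCount H us ∎

  module Potential (s a D K h : ℕ) (K≡ : suc K ≡ 2 * D) (2h≤n : 2 * h ≤ n)
    (room : ∀ {f g} → f ≤ m → m ≤ 2 * f → f ≤ g + s * L + B * (a + r) → f ^ r ≤ D * (g * a ^ r′))
    where

    open ≤-Reasoning

    G : State → ℕ
    G τ = gap (s ∸ length (hits τ))

    -- A hit at least halves the weight and a miss keeps it. Being linear in the indicator, the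
    -- inequality can be summed over all tuples.
    G-step : ∀ e c σ → 2 * G ((e , c) ∷ σ) + G σ * ι (hit? (hits σ) c) ≤ 2 * G σ
    G-step e c σ rewrite length-extend (hits σ) e c with hit? (hits σ) c
    ... | yes _ = begin
      2 * gap (s ∸ suc k) + gap (s ∸ k) * 1
        ≡⟨ cong₂ _+_ (cong (λ z → 2 * gap z) (sym (pred[m∸n]≡m∸[1+n] s k))) (*-identityʳ _) ⟩
      2 * gap (pred (s ∸ k)) + gap (s ∸ k)
        ≤⟨ +-monoˡ-≤ (gap (s ∸ k)) (gap-pred (s ∸ k)) ⟩
      gap (s ∸ k) + gap (s ∸ k)
        ≡⟨ cong (gap (s ∸ k) +_) (sym (+-identityʳ _)) ⟩
      2 * gap (s ∸ k) ∎
      where k = length (hits σ)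
    ... | no _ = ≤-reflexive (trans (cong (2 * gap (s ∸ length (hits σ)) +_)
                   (*-zeroʳ (gap (s ∸ length (hits σ))))) (+-identityʳ _))

    G-anti : ∀ e c σ → G ((e , c) ∷ σ) ≤ G σ
    G-anti e c σ = *-cancelˡ-≤ 2 (≤-trans (m≤m+n _ _) (G-step e c σ))

    ∑G-step : ∀ e σ → let ts = tuples r (used σ) in
      2 * ∑ ts (λ c → G ((e , c) ∷ σ)) + G σ * hitCount (hits σ) (used σ) ≤ 2 * (G σ * length ts)
    ∑G-step e σ = begin
      2 * ∑ ts (λ c → G ((e , c) ∷ σ)) + G σ * hitCount (hits σ) (used σ)
        ≡⟨ cong₂ _+_ (sym (∑-*ˡ ts 2 _)) (sym (∑-*ˡ ts (G σ) _)) ⟩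
      ∑ ts (λ c → 2 * G ((e , c) ∷ σ)) + ∑ ts (λ c → G σ * ι (hit? (hits σ) c))
        ≡⟨ sym (∑-+ ts _ _) ⟩
      ∑ ts (λ c → 2 * G ((e , c) ∷ σ) + G σ * ι (hit? (hits σ) c))
        ≤⟨ ∑-mono ts (λ {c} _ → G-step e c σ) ⟩
      ∑ ts (λ _ → 2 * G σ)
        ≡⟨ ∑-const ts _ ⟩
      length ts * (2 * G σ)
        ≡⟨ rearrange (length ts) (G σ) ⟩
      2 * (G σ * length ts) ∎
      where
      ts = tuples r (used σ)
      rearrange : ∀ x y → x * (2 * y) ≡ 2 * (y * x)
      rearrange = solve-∀

    -- Hit probability at least 1/D, weighted by `G σ`. Beyond s hits the weight is 0 and nothing
    -- has to be known about hits; otherwise `room` compares f^r, a bound on the number of tuples,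
    -- with the hits found by `hitCount-≥`.
    hits-dense : ∀ σ → ∣free∣ (used σ) ≤ m → m ≤ 2 * ∣free∣ (used σ) →
      G σ * length (tuples r (used σ)) ≤ D * (G σ * hitCount (hits σ) (used σ))
    hits-dense σ f≤m m≤2f with length (hits σ) ℕ.≤? s
    ... | no k≰s = subst (λ z → z * length (tuples r (used σ)) ≤ D * (z * hitCount (hits σ) (used σ)))
                     (sym (cong gap (m≤n⇒m∸n≡0 (<⇒≤ (≰⇒> k≰s))))) z≤n
    ... | yes k≤s with hitCount-≥ a (hits σ) (used σ)
    ...   | g , f≤ , hits≥ = begin
      G σ * length (tuples r (used σ))
        ≡⟨ cong (G σ *_) (length-tuples r (used σ)) ⟩
      G σ * fall f r
        ≤⟨ *-monoʳ-≤ (G σ) (≤-trans (fall≤^ f r) (room {f} {g} f≤m m≤2f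
             (≤-trans f≤ (+-monoˡ-≤ _ (+-monoʳ-≤ g (*-monoˡ-≤ L k≤s)))))) ⟩
      G σ * (D * (g * a ^ r′))
        ≤⟨ *-monoʳ-≤ (G σ) (*-monoʳ-≤ D hits≥) ⟩
      G σ * (D * hitCount (hits σ) (used σ))
        ≡⟨ rearrange (G σ) D (hitCount (hits σ) (used σ)) ⟩
      D * (G σ * hitCount (hits σ) (used σ)) ∎
      where
      f = ∣free∣ (used σ)
      rearrange : ∀ x y z → x * (y * z) ≡ y * (x * z)
      rearrange = solve-∀

    -- With `S`, `V`, `W` as below, 2S + V ≤ 2W and W ≤ DV give 2DS ≤ (2D - 1)W, and 2D = K + 1.
    contract : ∀ e σ → ∣free∣ (used σ) ≤ m → m ≤ 2 * ∣free∣ (used σ) →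
      suc K * ∑ (tuples r (used σ)) (λ c → G ((e , c) ∷ σ)) ≤ K * (G σ * length (tuples r (used σ)))
    contract e σ f≤m m≤2f = +-cancelˡ-≤ W _ _ (begin
      W + suc K * S                 ≤⟨ +-monoˡ-≤ _ (hits-dense σ f≤m m≤2f) ⟩
      D * V + suc K * S             ≡⟨ cong (λ z → D * V + z * S) K≡ ⟩
      D * V + 2 * D * S             ≡⟨ rearrange D V S ⟩
      D * (2 * S + V)               ≤⟨ *-monoʳ-≤ D (∑G-step e σ) ⟩
      D * (2 * W)                   ≡⟨ rearrange′ D W ⟩
      2 * D * W                     ≡⟨ cong (_* W) (sym K≡) ⟩
      W + K * W                     ∎)
      where
      S = ∑ (tuples r (used σ)) (λ c → G ((e , c) ∷ σ))
      V = G σ * hitCount (hits σ) (used σ)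
      W = G σ * length (tuples r (used σ))
      rearrange : ∀ D V S → D * V + 2 * D * S ≡ D * (2 * S + V)
      rearrange = solve-∀
      rearrange′ : ∀ D W → D * (2 * W) ≡ 2 * D * W
      rearrange′ = solve-∀

    -- All tuples have the same number `N` of continuations, so averaging over the later edges does
    -- not bias the present one and the factors Y/X and y/x multiply.
    compose : ∀ e es σ x y X Y → let ts = tuples r (used σ) in
      (∀ {c} → c ∈ ts → x * ∑ (arr es ((e , c) ∷ σ)) G ≤ y * (G ((e , c) ∷ σ) * length (arr es ((e , c) ∷ σ)))) →
      X * ∑ ts (λ c → G ((e , c) ∷ σ)) ≤ Y * (G σ * length ts) →
      X * x * ∑ (arr (e ∷ es) σ) G ≤ Y * y * (G σ * length (arr (e ∷ es) σ))
    compose e es σ x y X Y ih step = begin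
      X * x * ∑ (arr (e ∷ es) σ) G
        ≡⟨ trans (*-assoc X x _) (cong (X *_) (trans (cong (x *_) (∑-arr-∷ e es σ G)) (sym (∑-*ˡ ts x _)))) ⟩
      X * ∑ ts (λ c → x * ∑ (arr es ((e , c) ∷ σ)) G)
        ≤⟨ *-monoʳ-≤ X (∑-mono ts (λ {c} c∈ → ≤-trans (ih c∈) (≤-reflexive
             (cong (λ z → y * (G ((e , c) ∷ σ) * z)) (count c∈))))) ⟩
      X * ∑ ts (λ c → y * (G ((e , c) ∷ σ) * N))
        ≡⟨ cong (X *_) (trans (∑-*ˡ ts y _) (cong (y *_) (∑-*ʳ ts _ N))) ⟩
      X * (y * (∑ ts (λ c → G ((e , c) ∷ σ)) * N))
        ≡⟨ rearrange X y _ N ⟩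
      X * ∑ ts (λ c → G ((e , c) ∷ σ)) * (y * N)
        ≤⟨ *-monoˡ-≤ (y * N) step ⟩
      Y * (G σ * length ts) * (y * N)
        ≡⟨ rearrange′ Y (G σ) (length ts) y N ⟩
      Y * y * (G σ * (length ts * N))
        ≡⟨ cong (λ z → Y * y * (G σ * z)) (sym (trans (length-arr (e ∷ es) σ)
             (cong (_* N) (sym (length-tuples r (used σ)))))) ⟩
      Y * y * (G σ * length (arr (e ∷ es) σ)) ∎
      where
      ts = tuples r (used σ)
      N = arrCount (length es) (∣free∣ (used σ) ∸ r)
      count : ∀ {c} → c ∈ ts → length (arr es ((e , c) ∷ σ)) ≡ N
      count {c} c∈ = trans (length-arr es ((e , c) ∷ σ)) (cong (arrCount (length es))
        (sym (trans (cong (_∸ r) (tuples-free r c∈)) (m+n∸m≡n r _))))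
      rearrange : ∀ X y S N → X * (y * (S * N)) ≡ X * S * (y * N)
      rearrange = solve-∀
      rearrange′ : ∀ Y g l y N → Y * (g * l) * (y * N) ≡ Y * y * (g * (l * N))
      rearrange′ = solve-∀

    half-free : ∀ {f k} → m ≡ k * r + f → k < h → m ≤ 2 * f
    half-free {f} {k} eq k<h = +-cancelˡ-≤ m _ _ (begin
      m + m              ≡⟨ cong (m +_) (sym (+-identityʳ m)) ⟩
      2 * m              ≡⟨ cong (2 *_) eq ⟩
      2 * (k * r + f)    ≡⟨ rearrange k r f ⟩
      r * (2 * k) + 2 * f ≤⟨ +-monoˡ-≤ (2 * f) (*-monoʳ-≤ r (≤-trans (*-monoʳ-≤ 2 (<⇒≤ k<h)) 2h≤n)) ⟩
      m + 2 * f          ∎)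
      where
      rearrange : ∀ k r f → 2 * (k * r + f) ≡ r * (2 * k) + 2 * f
      rearrange = solve-∀

    -- Serves the edges after the first h, when too few positions may be free for a contraction:
    -- hits are never lost, so the weight cannot grow.
    decay₀ : ∀ es σ → 1 * ∑ (arr es σ) G ≤ 1 * (G σ * length (arr es σ))
    decay₀ [] σ = ≤-reflexive (cong (1 *_) (trans (+-identityʳ (G σ)) (sym (*-identityʳ (G σ)))))
    decay₀ (e ∷ es) σ = compose e es σ 1 1 1 1
      (λ {c} _ → decay₀ es ((e , c) ∷ σ))
      (*-monoʳ-≤ 1 (≤-trans (∑-mono (tuples r (used σ)) (λ {c} _ → G-anti e c σ))
        (≤-reflexive (trans (∑-const (tuples r (used σ)) (G σ)) (*-comm _ (G σ))))))

    decay : ∀ t es σ → t ≤ length es → length σ + t ≤ h → m ≡ length σ * r + ∣free∣ (used σ) →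
      suc K ^ t * ∑ (arr es σ) G ≤ K ^ t * (G σ * length (arr es σ))
    decay zero es σ _ _ _ = decay₀ es σ
    decay (suc t) (e ∷ es) σ (s≤s t≤) le eq =
      compose e es σ (suc K ^ t) (K ^ t) (suc K) K
        (λ {c} c∈ → decay t es ((e , c) ∷ σ) t≤ (≤-trans (≤-reflexive (sym (+-suc (length σ) t))) le)
          (trans eq (trans (cong (length σ * r +_) (tuples-free r c∈)) (rearrange (length σ * r) r _))))
        (contract e σ (≤-trans (m≤n+m _ (length σ * r)) (≤-reflexive (sym eq)))
          (half-free eq (≤-trans (s≤s (m≤m+n (length σ) t)) (≤-trans (≤-reflexive (sym (+-suc (length σ) t))) le))))
      where
      rearrange : ∀ x y z → x + (y + z) ≡ y + x + z
      rearrange = solve-∀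

    few-hits⇒1≤G : ∀ τ → ¬ (s ≤ length (hits τ)) → 1 ≤ G τ
    few-hits⇒1≤G τ s≰ = gap>0 (m<n⇒0<n∸m (≰⇒> s≰))

    -- A bad matching accounts for (r!)^n arrangements. None of them has s hits, as those would form
    -- a large line, so each has weight at least 1.
    bad≤∑G : Fin n → ∀ α β → (∀ k → s ≤ k → α * n ≤ β * k ^ r) →
      numBad r α β n * (r !) ^ n ≤ ∑ arrangements G
    bad≤∑G e₀ α β large = begin
      numBad r α β n * (r !) ^ n
        ≡⟨ cong (_* (r !) ^ n) (length-filterᵇ bad words) ⟩
      ∑ words (λ w → ι (T? (bad w))) * (r !) ^ n
        ≡⟨ sym (∑-*ʳ words (λ w → ι (T? (bad w))) ((r !) ^ n)) ⟩
      ∑ words (λ w → ι (T? (bad w)) * (r !) ^ n)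
        ≡⟨ ∑-cong words (λ {w} _ → weight w (T? (bad w))) ⟩
      ∑ words (λ w → ι (T? (bad w)) * ∏ (allFin n) (λ e → fall (occurrences w e) r))
        ≡⟨ word-count e₀ (λ w → ι (T? (bad w))) ⟩
      ∑ arrangements (λ τ → ι (T? (bad (word e₀ τ))))
        ≤⟨ ∑-mono arrangements (λ {τ} τ∈ → bad≤G τ∈ (T? (bad (word e₀ τ)))) ⟩
      ∑ arrangements G ∎
      where
      bad : Vec (Fin n) m → Bool
      bad w = isMatchingᵇ r n w ∧ not (hasLargeLineᵇ r α β n w)
      weight : ∀ w (d : Dec (T (bad w))) →
        ι d * (r !) ^ n ≡ ι d * ∏ (allFin n) (λ e → fall (occurrences w e) r)
      weight w (no _)  = refl
      weight w (yes b) = cong (1 *_) (sym (∏-matching {w} (proj₁ (Equivalence.to T-∧ b))))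
      bad≤G : ∀ {τ} → τ ∈ arrangements → (d : Dec (T (bad (word e₀ τ)))) → ι d ≤ G τ
      bad≤G τ∈ (no _) = z≤n
      bad≤G {τ} τ∈ (yes b) = few-hits⇒1≤G τ λ s≤ →
        T-not (proj₂ (Equivalence.to T-∧ b)) (arrangement-largeLine {e₀} {τ} α β τ∈ (large _ s≤))
        where
        T-not : ∀ {x} → T (not x) → ¬ T x
        T-not {false} _ ()

    -- Markov's inequality in counting form, with the empty state starting at weight at most 2^s.
    bad-decay : Fin n → ∀ α β → (∀ k → s ≤ k → α * n ≤ β * k ^ r) → h ≤ n →
      suc K ^ h * numBad r α β n ≤ K ^ h * 2 ^ s * numMatchings r n
    bad-decay e₀ α β large h≤n = *-cancelʳ-≤ _ _ ((r !) ^ n) {{m^n≢0 (r !) n {{r !≢0}}}} (begin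
      suc K ^ h * numBad r α β n * (r !) ^ n
        ≡⟨ *-assoc (suc K ^ h) _ _ ⟩
      suc K ^ h * (numBad r α β n * (r !) ^ n)
        ≤⟨ *-monoʳ-≤ (suc K ^ h) (bad≤∑G e₀ α β large) ⟩
      suc K ^ h * ∑ arrangements G
        ≤⟨ decay h (allFin n) [] (≤-trans h≤n (≤-reflexive (sym (length-allFin n)))) ≤-refl (sym ∣free∣-[]) ⟩
      K ^ h * (gap s * length arrangements)
        ≤⟨ *-monoʳ-≤ (K ^ h) (*-mono-≤ (gap≤2^ s) (arrangements≤matchings e₀)) ⟩
      K ^ h * (2 ^ s * (numMatchings r n * (r !) ^ n))
        ≡⟨ rearrange (K ^ h) (2 ^ s) (numMatchings r n) ((r !) ^ n) ⟩
      K ^ h * 2 ^ s * numMatchings r n * (r !) ^ n ∎)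
      where
      rearrange : ∀ w x y z → w * (x * (y * z)) ≡ w * x * y * z
      rearrange = solve-∀

open ≤-Reasoning

-- Arithmetic of the parameters

^-distribʳ-* : ∀ k x y → (x * y) ^ k ≡ x ^ k * y ^ k
^-distribʳ-* zero    x y = refl
^-distribʳ-* (suc k) x y = trans (cong (x * y *_) (^-distribʳ-* k x y)) (interchange x y (x ^ k) (y ^ k))
  where
  interchange : ∀ a b c d → a * b * (c * d) ≡ a * c * (b * d)
  interchange = solve-∀

n<2^n : ∀ n → n < 2 ^ n
n<2^n zero    = s≤s z≤n
n<2^n (suc n) = begin-strict
  suc n           <⟨ s≤s (n<2^n n) ⟩
  1 + 2 ^ n       ≤⟨ +-monoˡ-≤ (2 ^ n) (m^n>0 2 n) ⟩
  2 ^ n + 2 ^ n   ≡⟨ cong (2 ^ n +_) (sym (+-identityʳ _)) ⟩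
  2 ^ suc n       ∎

integer-root : ∀ c r → 0 < c → ∀ n → ∃ λ t → (c * t) ^ suc r ≤ n × n < (c * suc t) ^ suc r
integer-root c r 0<c zero = 0 , ≤-reflexive (cong (_^ suc r) (*-zeroʳ c)) ,
  m^n>0 (c * 1) {{>-nonZero (≤-trans 0<c (≤-reflexive (sym (*-identityʳ c))))}} (suc r)
integer-root c r 0<c (suc n) with integer-root c r 0<c n
... | t , lo , hi with (c * suc t) ^ suc r ℕ.≤? suc n
...   | no  ≰ = t , m≤n⇒m≤1+n lo , ≰⇒> ≰
...   | yes ≤ = suc t , ≤ , ≤-<-trans hi (^-monoˡ-< (suc r) (*-monoʳ-< c {{>-nonZero 0<c}} (n<1+n (suc t))))

-- Bernoulli's (1 + 1/k)^j ≥ 1 + j/k with denominators cleared, which also makes sense of k = 0.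
bernoulli : ∀ k j → k ^ j * (k + j) ≤ k * suc k ^ j
bernoulli k zero    = ≤-reflexive (trans (*-identityˡ _) (trans (+-identityʳ k) (sym (*-identityʳ k))))
bernoulli k (suc j) = begin
  k * k ^ j * (k + suc j)               ≤⟨ m≤m+n _ (k ^ j * j) ⟩
  k * k ^ j * (k + suc j) + k ^ j * j   ≡⟨ expand k j (k ^ j) ⟩
  suc k * (k ^ j * (k + j))             ≤⟨ *-monoʳ-≤ (suc k) (bernoulli k j) ⟩
  suc k * (k * suc k ^ j)               ≡⟨ swap (suc k) k (suc k ^ j) ⟩
  k * (suc k * suc k ^ j)               ∎
  where
  expand : ∀ k j x → k * x * (k + (1 + j)) + x * j ≡ (1 + k) * (x * (k + j))
  expand = solve-∀
  swap : ∀ a b c → a * (b * c) ≡ b * (a * c)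
  swap = solve-∀

-- That is, (1 + 1/k)^(k+1) ≥ 2. The case k = 0 is separate because a factor k is cancelled.
halving : ∀ k → 2 * k ^ suc k ≤ suc k ^ suc k
halving zero = z≤n
halving k@(suc _) = *-cancelˡ-≤ k (begin
  k * (2 * k ^ suc k)         ≡⟨ rearrange k (k ^ suc k) ⟩
  k ^ suc k * (k + k)         ≤⟨ *-monoʳ-≤ (k ^ suc k) (+-monoʳ-≤ k (n≤1+n k)) ⟩
  k ^ suc k * (k + suc k)     ≤⟨ bernoulli k (suc k) ⟩
  k * suc k ^ suc k           ∎)
  where
  rearrange : ∀ k x → k * (2 * x) ≡ x * (k + k)
  rearrange = solve-∀

halving-^ : ∀ k j → 2 ^ j * k ^ (suc k * j) ≤ suc k ^ (suc k * j)
halving-^ k j = begin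
  2 ^ j * k ^ (suc k * j)     ≡⟨ cong (2 ^ j *_) (sym (^-*-assoc k (suc k) j)) ⟩
  2 ^ j * (k ^ suc k) ^ j     ≡⟨ sym (^-distribʳ-* j 2 (k ^ suc k)) ⟩
  (2 * k ^ suc k) ^ j         ≤⟨ ^-monoˡ-≤ j (halving k) ⟩
  (suc k ^ suc k) ^ j         ≡⟨ ^-*-assoc (suc k) (suc k) j ⟩
  suc k ^ (suc k * j)         ∎

m<n*suc[m/n] : ∀ m n .{{_ : NonZero n}} → m < n * suc (m / n)
m<n*suc[m/n] m n = begin-strict
  m                      ≡⟨ m≡m%n+[m/n]*n m n ⟩
  m % n + m / n * n      <⟨ +-monoˡ-< (m / n * n) (m%n<n m n) ⟩
  n + m / n * n          ≡⟨ *-comm (suc (m / n)) n ⟩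
  n * suc (m / n)        ∎

∑-toℕ-point : ∀ {m} y → ∑ (allFin m) (λ x → ι (toℕ x ℕ.≟ y)) ≤ 1
∑-toℕ-point {m} y with y ℕ.<? m
... | yes y<m = ≤-reflexive (trans (∑-cong (allFin m) (λ {x} _ → trans
        (ι-cong (toℕ x ℕ.≟ y) (x Fin.≟ fromℕ< y<m)
          (λ eq → Fin.toℕ-injective (trans eq (sym (Fin.toℕ-fromℕ< y<m))))
          (λ { refl → Fin.toℕ-fromℕ< y<m }))
        (sym (*-identityʳ _)))) (∑-allFin-point (λ _ → 1) (fromℕ< y<m)))
... | no y≮m = ≤-trans (≤-reflexive (∑-zero (allFin m)
        (λ {x} _ → ι-no (toℕ x ℕ.≟ y) (λ { refl → y≮m (Fin.toℕ<n x) })))) z≤n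

-- Within block b a position is determined by its remainder, one of L values.
block-size : ∀ {m} L .{{_ : NonZero L}} b → ∑ (allFin m) (λ x → ι (toℕ x / L ℕ.≟ b)) ≤ L
block-size {m} L b = begin
  ∑ (allFin m) (λ x → ι (toℕ x / L ℕ.≟ b))
    ≤⟨ ∑-mono (allFin m) (λ {x} _ → offset (toℕ x) (toℕ x / L ℕ.≟ b)) ⟩
  ∑ (allFin m) (λ x → ∑ (upTo L) (λ j → ι (toℕ x ℕ.≟ j + b * L)))
    ≡⟨ ∑-swap (allFin m) (upTo L) _ ⟩
  ∑ (upTo L) (λ j → ∑ (allFin m) (λ x → ι (toℕ x ℕ.≟ j + b * L)))
    ≤⟨ ∑-mono (upTo L) (λ {j} _ → ∑-toℕ-point {m} (j + b * L)) ⟩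
  ∑ (upTo L) (λ _ → 1)
    ≡⟨ trans (sym (length≡∑ (upTo L))) (length-upTo L) ⟩
  L ∎
  where
  offset : ∀ y (d : Dec (y / L ≡ b)) → ι d ≤ ∑ (upTo L) (λ j → ι (y ℕ.≟ j + b * L))
  offset y (no _)     = z≤n
  offset y (yes refl) = ≤-trans
    (≤-reflexive (sym (ι-yes (y ℕ.≟ y % L + y / L * L) (m≡m%n+[m/n]*n y L))))
    (term≤∑ (λ j → ι (y ℕ.≟ j + b * L)) (∈-upTo⁺ (m%n<n y L)))

-- Accounting in units of m/8: at least four units are free; hit blocks hold at most t L ≤ m/8 + t,
-- where the rounding term t is at most a unit; sparse blocks hold at most one. This leaves g ≥ m/8,
-- and a ≥ m/(128 t) supplies the remaining factor of D.
room-bound : ∀ {r′ m t a f g} → 8 * t ≤ m → m ≤ 128 * t * a → 64 * t * (a + suc r′) ≤ m →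
  ∀ {L} → 8 * t * L ≤ 8 * t + m →
  f ≤ m → m ≤ 2 * f → f ≤ g + t * L + 8 * t * (a + suc r′) →
  f ^ suc r′ ≤ 8 * (128 * t) ^ r′ * (g * a ^ r′)
room-bound {r′} {m} {t} {a} {f} {g} 8t≤m m≤ta tq≤m {L} tL≤ f≤m m≤2f f≤ = begin
  f ^ suc r′                              ≤⟨ ^-monoˡ-≤ (suc r′) f≤m ⟩
  m * m ^ r′                              ≤⟨ *-mono-≤ m≤8g (^-monoˡ-≤ r′ m≤ta) ⟩
  8 * g * (128 * t * a) ^ r′              ≡⟨ cong (8 * g *_) (^-distribʳ-* r′ (128 * t) a) ⟩
  8 * g * ((128 * t) ^ r′ * a ^ r′)       ≡⟨ rearrange g ((128 * t) ^ r′) (a ^ r′) ⟩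
  8 * (128 * t) ^ r′ * (g * a ^ r′)       ∎
  where
  rearrange : ∀ g x y → 8 * g * (x * y) ≡ 8 * x * (g * y)
  rearrange = solve-∀
  q = a + suc r′
  times4 : ∀ f → 4 * (2 * f) ≡ 8 * f
  times4 = solve-∀
  expand : ∀ g t L q → 8 * (g + t * L + 8 * t * q) ≡ 8 * g + 8 * t * L + 64 * t * q
  expand = solve-∀
  collect : ∀ g t m → 8 * g + (8 * t + m) + m ≡ 8 * t + (8 * g + 2 * m)
  collect = solve-∀
  collect′ : ∀ g m → m + (8 * g + 2 * m) ≡ 3 * m + 8 * g
  collect′ = solve-∀
  four : ∀ m → 3 * m + m ≡ 4 * m
  four = solve-∀
  m≤8g : m ≤ 8 * g
  m≤8g = +-cancelˡ-≤ (3 * m) _ _ (begin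
    3 * m + m                            ≡⟨ four m ⟩
    4 * m                                ≤⟨ *-monoʳ-≤ 4 m≤2f ⟩
    4 * (2 * f)                          ≡⟨ times4 f ⟩
    8 * f                                ≤⟨ *-monoʳ-≤ 8 f≤ ⟩
    8 * (g + t * L + 8 * t * q)          ≡⟨ expand g t L q ⟩
    8 * g + 8 * t * L + 64 * t * q       ≤⟨ +-mono-≤ (+-monoʳ-≤ (8 * g) tL≤) tq≤m ⟩
    8 * g + (8 * t + m) + m              ≡⟨ collect g t m ⟩
    8 * t + (8 * g + 2 * m)              ≤⟨ +-monoˡ-≤ _ 8t≤m ⟩
    m + (8 * g + 2 * m)                  ≡⟨ collect′ g m ⟩
    3 * m + 8 * g                        ∎)

-- Choice of the parameters and the final bound

module Bound (r″ n t : ℕ) (0<t : 0 < t)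
  (lo : (128 * t) ^ suc (suc r″) ≤ n) (hi : n < (128 * suc t) ^ suc (suc r″)) where

  private
    r′ = suc r″
    r  = suc r′
    m  = r * n
    instance
      _ : NonZero t
      _ = >-nonZero 0<t
      8t≢0 : NonZero (8 * t)
      8t≢0 = m*n≢0 8 t
      64t≢0 : NonZero (64 * t)
      64t≢0 = m*n≢0 64 t
      128t≢0 : NonZero (128 * t)
      128t≢0 = m*n≢0 128 t
    -- The block length `L` is rounded up so that 8t blocks cover all m positions. The threshold `q`
    -- is an eighth of the average block size m/(8t), and `a` keeps r of these positions in reserve.
    -- `h` is 4Dt, written in the form that `halving-^` takes with exponent t + t.
    L q a D K h : ℕ
    L = suc (m / (8 * t))
    q = m / (64 * t)
    a = q ∸ r
    D = 8 * (128 * t) ^ r′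
    K = pred (2 * D)
    h = suc K * (t + t)

  -- Here r ≥ 2 enters, through (128 t)^2 ≤ (128 t)^r. As 192 is 3 times 64, it gives q ≥ 3r.
  192t≤n : 192 * t ≤ n
  192t≤n = begin
    192 * t                 ≤⟨ *-monoˡ-≤ t {192} {256} (m≤m+n 192 64) ⟩
    256 * t                 ≡⟨ double t ⟩
    128 * t * 2             ≤⟨ *-monoʳ-≤ (128 * t) (*-mono-≤ {2} {128} {1} {t} (m≤m+n 2 126) 0<t) ⟩
    128 * t * (128 * t)     ≤⟨ *-monoʳ-≤ (128 * t) (≤-trans (≤-reflexive (sym (*-identityʳ _)))
                                 (*-monoʳ-≤ (128 * t) (m^n>0 (128 * t) r″))) ⟩
    (128 * t) ^ r           ≤⟨ lo ⟩
    n                       ∎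
    where
    double : ∀ t → 256 * t ≡ 128 * t * 2
    double = solve-∀

  -- Equivalent to q + 1 ≤ 2 (q - r): the reserve of r positions and the rounding of q together cost
  -- at most a factor 2, which turns 64 into 128.
  2r+1≤q : suc (2 * r) ≤ q
  2r+1≤q = begin
    suc (2 * r)                           ≡⟨ sym (m*n/n≡m (suc (2 * r)) (64 * t)) ⟩
    suc (2 * r) * (64 * t) / (64 * t)     ≤⟨ /-monoˡ-≤ (64 * t) (begin
      suc (2 * r) * (64 * t)                ≤⟨ *-monoˡ-≤ (64 * t) (+-monoˡ-≤ (2 * r) (s≤s (z≤n {r′}))) ⟩
      (r + 2 * r) * (64 * t)                ≡⟨ collect r t ⟩
      r * (192 * t)                         ≤⟨ *-monoʳ-≤ r 192t≤n ⟩
      m                                     ∎) ⟩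
    q                                     ∎
    where
    collect : ∀ r t → (r + 2 * r) * (64 * t) ≡ r * (192 * t)
    collect = solve-∀

  a+r≡q : a + r ≡ q
  a+r≡q = m∸n+n≡m (≤-trans (m≤m+n r (r + 0)) (≤-trans (n≤1+n _) 2r+1≤q))

  suc-q≤2a : suc q ≤ 2 * a
  suc-q≤2a = +-cancelʳ-≤ (2 * r) _ _ (begin
    suc q + 2 * r       ≡⟨ sym (+-suc q (2 * r)) ⟩
    q + suc (2 * r)     ≤⟨ +-monoʳ-≤ q 2r+1≤q ⟩
    q + q               ≡⟨ cong₂ _+_ (sym a+r≡q) (sym a+r≡q) ⟩
    a + r + (a + r)     ≡⟨ double a r ⟩
    2 * a + 2 * r       ∎)
    where
    double : ∀ a r → a + r + (a + r) ≡ 2 * a + 2 * r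
    double = solve-∀

  m≤128ta : m ≤ 128 * t * a
  m≤128ta = begin
    m                       ≤⟨ <⇒≤ (m<n*suc[m/n] m (64 * t)) ⟩
    64 * t * suc q          ≤⟨ *-monoʳ-≤ (64 * t) suc-q≤2a ⟩
    64 * t * (2 * a)        ≡⟨ double t a ⟩
    128 * t * a             ∎
    where
    double : ∀ t a → 64 * t * (2 * a) ≡ 128 * t * a
    double = solve-∀

  64tq≤m : 64 * t * (a + r) ≤ m
  64tq≤m = begin
    64 * t * (a + r)      ≡⟨ cong (64 * t *_) a+r≡q ⟩
    64 * t * q            ≡⟨ *-comm (64 * t) q ⟩
    q * (64 * t)          ≤⟨ m/n*n≤m m (64 * t) ⟩
    m                     ∎

  8t≤m : 8 * t ≤ m
  8t≤m = ≤-trans (*-monoˡ-≤ t {8} {192} (m≤m+n 8 184)) (≤-trans 192t≤n (m≤m+n n (r′ * n)))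

  8tL≤ : 8 * t * L ≤ 8 * t + m
  8tL≤ = begin
    8 * t * L                             ≡⟨ *-suc (8 * t) (m / (8 * t)) ⟩
    8 * t + 8 * t * (m / (8 * t))         ≡⟨ cong (8 * t +_) (*-comm (8 * t) (m / (8 * t))) ⟩
    8 * t + m / (8 * t) * (8 * t)         ≤⟨ +-monoʳ-≤ (8 * t) (m/n*n≤m m (8 * t)) ⟩
    8 * t + m                             ∎

  suc-K : suc K ≡ 2 * D
  suc-K = suc-pred (2 * D) {{m*n≢0 2 D {{_}} {{m*n≢0 8 ((128 * t) ^ r′) {{_}} {{m^n≢0 (128 * t) r′}}}}}}

  2h≤n : 2 * h ≤ n
  2h≤n = begin
    2 * (suc K * (t + t))                             ≡⟨ cong (λ z → 2 * (z * (t + t))) suc-K ⟩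
    2 * (2 * (8 * (128 * t) ^ r′) * (t + t))          ≡⟨ collect t ((128 * t) ^ r′) ⟩
    64 * t * (128 * t) ^ r′                           ≤⟨ *-monoˡ-≤ ((128 * t) ^ r′) (*-monoˡ-≤ t {64} {128} (m≤m+n 64 64)) ⟩
    (128 * t) ^ r                                     ≤⟨ lo ⟩
    n                                                 ∎
    where
    collect : ∀ t x → 2 * (2 * (8 * x) * (t + t)) ≡ 64 * t * x
    collect = solve-∀

  -- Rounding the root down to t is paid for by t + 1 ≤ 2t, which doubles 128 to 256.
  large : ∀ k → t ≤ k → 1 * n ≤ 256 ^ r * k ^ r
  large k t≤k = begin
    1 * n                   ≡⟨ *-identityˡ n ⟩
    n                       ≤⟨ <⇒≤ hi ⟩
    (128 * suc t) ^ r       ≤⟨ ^-monoˡ-≤ r (begin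
      128 * suc t             ≡⟨ *-suc 128 t ⟩
      128 * 1 + 128 * t       ≤⟨ +-monoˡ-≤ (128 * t) (*-monoʳ-≤ 128 {1} {t} 0<t) ⟩
      128 * t + 128 * t       ≡⟨ double t ⟩
      256 * t                 ≤⟨ *-monoʳ-≤ 256 t≤k ⟩
      256 * k                 ∎) ⟩
    (256 * k) ^ r           ≡⟨ ^-distribʳ-* r 256 k ⟩
    256 ^ r * k ^ r         ∎
    where
    double : ∀ t → 128 * t + 128 * t ≡ 256 * t
    double = solve-∀

  blk : Fin m → ℕ
  blk x = toℕ x / L

  blk-mono : ∀ {x y} → blk x < blk y → toℕ x < toℕ y
  blk-mono {x} {y} bx<by with toℕ x ℕ.<? toℕ y
  ... | yes x<y = x<y
  ... | no x≮y  = contradiction (/-monoˡ-≤ L (≮⇒≥ x≮y)) (<⇒≱ bx<by)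

  blk<8t : ∀ x → blk x < 8 * t
  blk<8t x = m<n*o⇒m/o<n (<-trans (Fin.toℕ<n x) (m<n*suc[m/n] m (8 * t)))

  open Decay {r′} {n} blk blk-mono (8 * t) L blk<8t (block-size {m} L)
  open Potential t a D K h suc-K 2h≤n (λ {f} {g} → room-bound {r′} {m} {t} {a} {f} {g} 8t≤m m≤128ta 64tq≤m {L} 8tL≤)

  0<n : 0 < n
  0<n = ≤-trans 0<t (≤-trans (m≤m+n t _) 192t≤n)

  -- Of the factor 2^(2t) gained by `halving-^`, one 2^t cancels the initial weight and the other
  -- remains as the bound.
  bad-bound : 2 ^ t * numBad r 1 (256 ^ r) n ≤ numMatchings r n
  bad-bound = *-cancelˡ-≤ (2 ^ t * suc K ^ h) {{m*n≢0 (2 ^ t) (suc K ^ h) {{m^n≢0 2 t}} {{m^n≢0 (suc K) h}}}} (begin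
    2 ^ t * suc K ^ h * (2 ^ t * bad)          ≡⟨ rearrange (2 ^ t) (suc K ^ h) bad ⟩
    2 ^ t * 2 ^ t * (suc K ^ h * bad)          ≤⟨ *-monoʳ-≤ (2 ^ t * 2 ^ t)
                                                    (bad-decay (fromℕ< 0<n) 1 (256 ^ r) large (≤-trans (m≤m+n h _) 2h≤n)) ⟩
    2 ^ t * 2 ^ t * (K ^ h * 2 ^ t * M)        ≡⟨ cong (_* (K ^ h * 2 ^ t * M)) (sym (^-distribˡ-+-* 2 t t)) ⟩
    2 ^ (t + t) * (K ^ h * 2 ^ t * M)          ≡⟨ rearrange′ (2 ^ (t + t)) (K ^ h) (2 ^ t) M ⟩
    2 ^ (t + t) * K ^ h * (2 ^ t * M)          ≤⟨ *-monoˡ-≤ (2 ^ t * M) (halving-^ K (t + t)) ⟩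
    suc K ^ h * (2 ^ t * M)                    ≡⟨ rearrange″ (suc K ^ h) (2 ^ t) M ⟩
    2 ^ t * suc K ^ h * M                      ∎)
    where
    bad = numBad r 1 (256 ^ r) n
    M = numMatchings r n
    rearrange : ∀ x y z → x * y * (x * z) ≡ x * x * (y * z)
    rearrange = solve-∀
    rearrange′ : ∀ w x y z → w * (x * y * z) ≡ w * x * (y * z)
    rearrange′ = solve-∀
    rearrange″ : ∀ x y z → x * (y * z) ≡ y * x * z
    rearrange″ = solve-∀

tail-bound : ∀ r″ p q → 0 < p → 0 < q → let r = suc (suc r″) in
  ∀ n → (128 * suc q) ^ r ≤ n → q * numBad r 1 (256 ^ r) n ≤ p * numMatchings r n
tail-bound r″ p q 0<p 0<q n N≤n = at-root (integer-root 128 (suc r″) (s≤s z≤n) n)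
  where
  r = suc (suc r″)
  bad = numBad r 1 (256 ^ r) n
  M = numMatchings r n
  at-root : (∃ λ t → (128 * t) ^ r ≤ n × n < (128 * suc t) ^ r) → q * bad ≤ p * M
  at-root (t , lo , hi) = begin
    q * bad         ≤⟨ *-monoˡ-≤ bad (≤-trans (<⇒≤ q<t) (<⇒≤ (n<2^n t))) ⟩
    2 ^ t * bad     ≤⟨ Bound.bad-bound r″ n t (≤-trans 0<q (<⇒≤ q<t)) lo hi ⟩
    M               ≡⟨ sym (*-identityˡ M) ⟩
    1 * M           ≤⟨ *-monoˡ-≤ M 0<p ⟩
    p * M           ∎
    where
    -- If t ≤ q, then n < (128 (t + 1))^r ≤ (128 (q + 1))^r ≤ n. From q < t follows 2^(-t) < 1/q ≤
    -- p/q.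
    q<t : q < t
    q<t = ≰⇒> λ t≤q → <⇒≱ hi (≤-trans (^-monoˡ-≤ r (*-monoʳ-≤ 128 {suc t} {suc q} (s≤s t≤q))) N≤n)

theoremC1 : (r : ℕ) → 2 ≤ r →
    Σ ℕ λ a → Σ ℕ λ b → 0 < a × 0 < b ×
    ((p q : ℕ) → 0 < p → 0 < q →
    Σ ℕ λ N → (n : ℕ) → N ≤ n →
    q * numBad r a b n ≤ p * numMatchings r n)
-- The witnesses encode c^r = 1/256^r, so c = 1/256; p/q is the tolerated probability of failure.
theoremC1 (suc (suc r″)) (s≤s (s≤s _)) = 1 , 256 ^ suc (suc r″) , s≤s z≤n , m^n>0 256 (suc (suc r″)) ,
  λ p q 0<p 0<q → (128 * suc q) ^ suc (suc r″) , tail-bound r″ p q 0<p 0<q
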